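{- Let $p>0$ be an integer. Then for every $x$ with $|x|<1$, $$\sum_{n=1}^{\infty}\left(1^p+2^p+\dots+n^p\right)x^n = \frac{1}{(1-x)^2}\,\omega_p\!\left(\frac{x}{1-x}\right).$$
   Context: $S(p,k)$ denotes the Stirling numbers of the second kind. The geometric polynomials are $\omega_p(x)=\sum_{k=0}^{p} S(p,k)\,k!\,x^k$ for integers $p\ge 0$, so $\omega_0(x)=1$, $\omega_1(x)=x$, $\omega_2(x)=2x^2+x$. Here $x$ is a real or complex number. -}

module Defs where

open import Algebra.Bundles.Raw using (RawRing)
open import Data.Integer.Base as ℤ using (+_)
import Data.Integer.Properties as ℤ
open import Data.Nat.Base as ℕ using (ℕ; zero; suc; _!)
import Data.Nat.DivMod as ℕ
import Data.Nat.Properties as ℕ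
import Data.Nat.Solver as ℕ
open import Data.Product.Base using (∃-syntax; _×_; _,_; proj₁; proj₂)
open import Data.Rational.Base as ℚ
  using (ℚ; mkℚ; 0ℚ; 1ℚ; ½; _+_; _*_; _-_; -_; _≤_; _<_; ∣_∣; toℚᵘ; ↥_; ↧ₙ_)
open import Data.Rational.Properties
open import Data.Rational.Solver
open import Data.Rational.Unnormalised.Base as ℚᵘ using (mkℚᵘ)
import Data.Rational.Unnormalised.Properties as ℚᵘ
open import Data.Sum.Base using (inj₁; inj₂)
open import Function.Base using (_∘_)
open import Level using (0ℓ)
open import Relation.Binary.PropositionalEquality
open import Relation.Nullary using (yes; no; contradiction)

open +-*-Solver using (solve; _:=_; _:+_; _:*_; _:-_; :-_; con)

private variable
  a b c d p q ε : ℚ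

0<½ : 0ℚ < ½
0<½ = positive⁻¹ ½

0<1 : 0ℚ < 1ℚ
0<1 = positive⁻¹ 1ℚ

0<* : 0ℚ < a → 0ℚ < b → 0ℚ < a * b
0<* {a} {b} 0<a 0<b =
  positive⁻¹ (a * b) {{pos*pos⇒pos a {{ℚ.positive 0<a}} b {{ℚ.positive 0<b}}}}

0≤* : 0ℚ ≤ a → 0ℚ ≤ b → 0ℚ ≤ a * b
0≤* {a} {b} 0≤a 0≤b =
  nonNegative⁻¹ (a * b)
    {{nonNeg*nonNeg⇒nonNeg a {{ℚ.nonNegative 0≤a}} b {{ℚ.nonNegative 0≤b}}}}

0≤sq : ∀ a → 0ℚ ≤ a * a
0≤sq a with ≤-total 0ℚ a
... | inj₁ 0≤a = 0≤* 0≤a 0≤a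
... | inj₂ a≤0 = subst (0ℚ ≤_) (solve 1 (λ x → :- x :* :- x := x :* x) refl a)
                   (0≤* (neg-antimono-≤ a≤0) (neg-antimono-≤ a≤0))

*-mono-≤ : 0ℚ ≤ a → a ≤ b → 0ℚ ≤ c → c ≤ d → a * c ≤ b * d
*-mono-≤ {a} {b} {c} {d} 0≤a a≤b 0≤c c≤d = ≤-trans
  (*-monoʳ-≤-nonNeg c {{ℚ.nonNegative 0≤c}} a≤b)
  (*-monoˡ-≤-nonNeg b {{ℚ.nonNegative (≤-trans 0≤a a≤b)}} c≤d)

*-mono-< : 0ℚ ≤ a → a < b → 0ℚ ≤ c → c < d → a * c < b * d
*-mono-< {a} {b} {c} {d} 0≤a a<b 0≤c c<d = ≤-<-trans
  (*-monoʳ-≤-nonNeg c {{ℚ.nonNegative 0≤c}} (<⇒≤ a<b))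
  (*-monoʳ-<-pos b {{ℚ.positive (≤-<-trans 0≤a a<b)}} c<d)

∣∣-lub-< : p < ε → - p < ε → ∣ p ∣ < ε
∣∣-lub-< {p} {ε} p<ε -p<ε with ∣p∣≡p∨∣p∣≡-p p
... | inj₁ eq = subst (_< ε) (sym eq) p<ε
... | inj₂ eq = subst (_< ε) (sym eq) -p<ε

½+½ : ∀ ε → ½ * ε + ½ * ε ≡ ε
½+½ = solve 1 (λ e → con ½ :* e :+ con ½ :* e := e) refl

0<½* : 0ℚ < ε → 0ℚ < ½ * ε
0<½* = 0<* 0<½

divide : 0ℚ < b → 0ℚ < ε → ∃[ δ ] 0ℚ < δ × b * δ ≡ ε
divide {b} {ε} 0<b 0<ε =
  (ℚ.1/ b) * ε , 0<* (positive⁻¹ (ℚ.1/ b) {{1/pos⇒pos b}}) 0<ε , eq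
  where
  instance
    b⁺ = ℚ.positive 0<b
    b≠0 = pos⇒nonZero b
  eq : b * ((ℚ.1/ b) * ε) ≡ ε
  eq = trans (sym (*-assoc b (ℚ.1/ b) ε))
             (trans (cong (_* ε) (*-inverseʳ b)) (*-identityˡ ε))

-- Opaque only to keep rational normal forms from being unfolded.
opaque
  unitFraction : ℕ → ℚ
  unitFraction n = + 1 ℚ./ suc n

  0≤unitFraction : ∀ n → 0ℚ ≤ unitFraction n
  0≤unitFraction n = nonNegative⁻¹ _ {{normalize-nonNeg 1 (suc n)}}

  unitFraction-small : 0ℚ < ε → ∃[ N ] (∀ n → N ℕ.≤ n → unitFraction n < ε)
  unitFraction-small {mkℚ (+ zero) _ _} 0<ε =
    contradiction (drop-*<* 0<ε) λ { (ℤ.+<+ ()) }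
  unitFraction-small {mkℚ ℤ.-[1+ _ ] _ _} 0<ε = contradiction (drop-*<* 0<ε) λ ()
  unitFraction-small {ε@(mkℚ (+ suc k) d _)} 0<ε = suc d , λ n d<n →
    toℚᵘ-cancel-< (ℚᵘ.<-respˡ-≃ (ℚᵘ.≃-sym (toℚᵘ-fromℚᵘ (mkℚᵘ (+ 1) n)))
      (ℚᵘ.*<* (ℤ.+<+ (begin-strict
        1 ℕ.* suc d     ≡⟨ ℕ.*-identityˡ (suc d) ⟩
        suc d           <⟨ ℕ.s≤s d<n ⟩
        suc n           ≤⟨ ℕ.m≤n*m (suc n) (suc k) ⟩
        suc k ℕ.* suc n ∎))))
    where open ℕ.≤-Reasoning

-- The existential in `Cauchy` is a Σ-type, so a real
-- carries a modulus of convergence.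

Cauchy : (ℕ → ℚ) → Set
Cauchy s = ∀ ε → 0ℚ < ε →
  ∃[ N ] (∀ m n → N ℕ.≤ m → N ℕ.≤ n → ∣ s m - s n ∣ < ε)

record ℝ : Set where
  constructor mkℝ
  field
    seq    : ℕ → ℚ
    cauchy : Cauchy seq

open ℝ public

infix 4 _≃ℝ_ _<ℝ_

_≃ℝ_ : ℝ → ℝ → Set
x ≃ℝ y = ∀ ε → 0ℚ < ε → ∃[ N ] (∀ n → N ℕ.≤ n → ∣ seq x n - seq y n ∣ < ε)

_<ℝ_ : ℝ → ℝ → Set
x <ℝ y = ∃[ ε ] 0ℚ < ε × ∃[ N ] (∀ n → N ℕ.≤ n → seq x n + ε < seq y n)

fromℚ : ℚ → ℝ
fromℚ q = mkℝ (λ _ → q) λ ε 0<ε →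
  0 , λ _ _ _ _ → subst (_< ε) (sym (cong ∣_∣ (+-inverseʳ q))) 0<ε

0ℝ 1ℝ : ℝ
0ℝ = fromℚ 0ℚ
1ℝ = fromℚ 1ℚ

infixl 6 _+ℝ_
infixl 7 _*ℝ_
infix  8 -ℝ_

_+ℝ_ : ℝ → ℝ → ℝ
mkℝ x cx +ℝ mkℝ y cy = mkℝ (λ n → x n + y n) λ ε 0<ε →
  let M , hx = cx (½ * ε) (0<½* 0<ε)
      N , hy = cy (½ * ε) (0<½* 0<ε)
  in M ℕ.⊔ N , λ m n le le′ → begin-strict
    ∣ (x m + y m) - (x n + y n) ∣
      ≡⟨ cong ∣_∣ (solve 4 (λ a b c d → (a :+ b) :- (c :+ d) := (a :- c) :+ (b :- d))
                         refl (x m) (y m) (x n) (y n)) ⟩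
    ∣ (x m - x n) + (y m - y n) ∣     ≤⟨ ∣p+q∣≤∣p∣+∣q∣ (x m - x n) (y m - y n) ⟩
    ∣ x m - x n ∣ + ∣ y m - y n ∣
      <⟨ +-mono-< (hx m n (ℕ.m⊔n≤o⇒m≤o M N le) (ℕ.m⊔n≤o⇒m≤o M N le′))
                  (hy m n (ℕ.m⊔n≤o⇒n≤o M N le) (ℕ.m⊔n≤o⇒n≤o M N le′)) ⟩
    ½ * ε + ½ * ε                     ≡⟨ ½+½ ε ⟩
    ε                                 ∎
  where open ≤-Reasoning

-ℝ_ : ℝ → ℝ
-ℝ mkℝ x cx = mkℝ (λ n → - x n) λ ε 0<ε →
  let N , h = cx ε 0<ε
  in N , λ m n le le′ → subst (_< ε)
       (trans (sym (∣-p∣≡∣p∣ (x m - x n)))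
              (cong ∣_∣ (neg-distrib-+ (x m) (- x n))))
       (h m n le le′)

bounded : ∀ {s} → Cauchy s → ∃[ B ] 0ℚ < B × ∃[ N ] (∀ n → N ℕ.≤ n → ∣ s n ∣ < B)
bounded {s} cs = B , 0<B , N , λ n le → begin-strict
    ∣ s n ∣               ≡⟨ cong ∣_∣ (solve 2 (λ a b → a := (a :- b) :+ b) refl (s n) (s N)) ⟩
    ∣ (s n - s N) + s N ∣ ≤⟨ ∣p+q∣≤∣p∣+∣q∣ (s n - s N) (s N) ⟩
    ∣ s n - s N ∣ + ∣ s N ∣ <⟨ +-monoˡ-< ∣ s N ∣ (h n N le ℕ.≤-refl) ⟩
    B ∎
  where
  open ≤-Reasoning
  N = proj₁ (cs 1ℚ 0<1)
  h = proj₂ (cs 1ℚ 0<1)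
  B = 1ℚ + ∣ s N ∣
  0<B : 0ℚ < B
  0<B = +-mono-<-≤ 0<1 (0≤∣p∣ (s N))

_*ℝ_ : ℝ → ℝ → ℝ
mkℝ x cx *ℝ mkℝ y cy = mkℝ (λ n → x n * y n) λ ε 0<ε →
  let A , 0<A , K , bx = bounded cx
      B , 0<B , L , by = bounded cy
      α , 0<α , Bα = divide 0<B (0<½* 0<ε)
      β , 0<β , Aβ = divide 0<A (0<½* 0<ε)
      M , hx = cx α 0<α
      N , hy = cy β 0<β
  in (K ℕ.⊔ L) ℕ.⊔ (M ℕ.⊔ N) , λ m n le le′ →
  let lm = ℕ.m⊔n≤o⇒m≤o (K ℕ.⊔ L) (M ℕ.⊔ N) le
      ln = ℕ.m⊔n≤o⇒m≤o (K ℕ.⊔ L) (M ℕ.⊔ N) le′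
      rm = ℕ.m⊔n≤o⇒n≤o (K ℕ.⊔ L) (M ℕ.⊔ N) le
      rn = ℕ.m⊔n≤o⇒n≤o (K ℕ.⊔ L) (M ℕ.⊔ N) le′
  in begin-strict
    ∣ x m * y m - x n * y n ∣
      ≡⟨ cong ∣_∣ (solve 4 (λ a b c d → a :* b :- c :* d := a :* (b :- d) :+ d :* (a :- c))
                         refl (x m) (y m) (x n) (y n)) ⟩
    ∣ x m * (y m - y n) + y n * (x m - x n) ∣
      ≤⟨ ∣p+q∣≤∣p∣+∣q∣ (x m * (y m - y n)) (y n * (x m - x n)) ⟩
    ∣ x m * (y m - y n) ∣ + ∣ y n * (x m - x n) ∣
      ≡⟨ cong₂ _+_ (∣p*q∣≡∣p∣*∣q∣ (x m) (y m - y n)) (∣p*q∣≡∣p∣*∣q∣ (y n) (x m - x n)) ⟩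
    ∣ x m ∣ * ∣ y m - y n ∣ + ∣ y n ∣ * ∣ x m - x n ∣
      <⟨ +-mono-<
           (*-mono-< (0≤∣p∣ (x m)) (bx m (ℕ.m⊔n≤o⇒m≤o K L lm)) (0≤∣p∣ (y m - y n))
             (hy m n (ℕ.m⊔n≤o⇒n≤o M N rm) (ℕ.m⊔n≤o⇒n≤o M N rn)))
           (*-mono-< (0≤∣p∣ (y n)) (by n (ℕ.m⊔n≤o⇒n≤o K L ln)) (0≤∣p∣ (x m - x n))
             (hx m n (ℕ.m⊔n≤o⇒m≤o M N rm) (ℕ.m⊔n≤o⇒m≤o M N rn))) ⟩
    A * β + B * α                     ≡⟨ cong₂ _+_ Aβ Bα ⟩
    ½ * ε + ½ * ε                     ≡⟨ ½+½ ε ⟩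
    ε                                 ∎
  where open ≤-Reasoning

recip : ℚ → ℚ
recip q with q ≟ 0ℚ
... | yes _   = 0ℚ
... | no  q≢0 = ℚ.1/_ q {{ℚ.≢-nonZero q≢0}}

recip-inverse : 0ℚ < q → q * recip q ≡ 1ℚ
recip-inverse {q} 0<q with q ≟ 0ℚ
... | yes q≡0 = contradiction (sym q≡0) (<⇒≢ 0<q)
... | no  q≢0 = *-inverseʳ q {{ℚ.≢-nonZero q≢0}}

recip-difference : 0ℚ < p → 0ℚ < q → (p * q) * (recip p - recip q) ≡ q - p
recip-difference {p} {q} 0<p 0<q = begin
  (p * q) * (recip p - recip q)
    ≡⟨ solve 4 (λ p q r s → (p :* q) :* (r :- s) := (p :* r) :* q :- (q :* s) :* p)
             refl p q (recip p) (recip q) ⟩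
  (p * recip p) * q - (q * recip q) * p
    ≡⟨ cong₂ (λ u v → u * q - v * p) (recip-inverse 0<p) (recip-inverse 0<q) ⟩
  1ℚ * q - 1ℚ * p
    ≡⟨ cong₂ _-_ (*-identityˡ q) (*-identityˡ p) ⟩
  q - p ∎
  where open ≡-Reasoning

recipℝ : (x : ℝ) → 0ℝ <ℝ x → ℝ
recipℝ (mkℝ x cx) (c , 0<c , M , pos) = mkℝ (recip ∘ x) λ ε 0<ε →
  let N , h = cx ((c * c) * ε) (0<* (0<* 0<c 0<c) 0<ε)
  in M ℕ.⊔ N , λ m n le le′ →
  let c<xm = c<x m (ℕ.m⊔n≤o⇒m≤o M N le)
      c<xn = c<x n (ℕ.m⊔n≤o⇒m≤o M N le′)
      0<xm = <-trans 0<c c<xm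
      0<xn = <-trans 0<c c<xn
      r    = recip (x m) - recip (x n)
  in *-cancelˡ-<-nonNeg (c * c) {{ℚ.nonNegative (0≤sq c)}} (begin-strict
    (c * c) * ∣ r ∣
      ≤⟨ *-monoʳ-≤-nonNeg ∣ r ∣ {{∣-∣-nonNeg r}}
           (*-mono-≤ (<⇒≤ 0<c) (<⇒≤ c<xm) (<⇒≤ 0<c) (<⇒≤ c<xn)) ⟩
    (x m * x n) * ∣ r ∣
      ≡⟨ cong (_* ∣ r ∣) (0≤p⇒∣p∣≡p (0≤* (<⇒≤ 0<xm) (<⇒≤ 0<xn))) ⟨
    ∣ x m * x n ∣ * ∣ r ∣          ≡⟨ ∣p*q∣≡∣p∣*∣q∣ (x m * x n) r ⟨
    ∣ (x m * x n) * r ∣            ≡⟨ cong ∣_∣ (recip-difference 0<xm 0<xn) ⟩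
    ∣ x n - x m ∣
      <⟨ h n m (ℕ.m⊔n≤o⇒n≤o M N le′) (ℕ.m⊔n≤o⇒n≤o M N le) ⟩
    (c * c) * ε                    ∎)
  where
  open ≤-Reasoning
  c<x : ∀ n → M ℕ.≤ n → c < x n
  c<x n le = subst (_< x n) (+-identityˡ c) (pos n le)

isqrt : ℕ → ℕ
isqrt zero = 0
isqrt (suc n) with suc (isqrt n) ℕ.* suc (isqrt n) ℕ.≤? suc n
... | yes _ = suc (isqrt n)
... | no  _ = isqrt n

isqrt-lower : ∀ n → isqrt n ℕ.* isqrt n ℕ.≤ n
isqrt-lower zero = ℕ.z≤n
isqrt-lower (suc n) with suc (isqrt n) ℕ.* suc (isqrt n) ℕ.≤? suc n
... | yes le = le
... | no  _  = ℕ.m≤n⇒m≤1+n (isqrt-lower n)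

isqrt-upper : ∀ n → n ℕ.< suc (isqrt n) ℕ.* suc (isqrt n)
isqrt-upper zero = ℕ.s≤s ℕ.z≤n
isqrt-upper (suc n) with suc (isqrt n) ℕ.* suc (isqrt n) ℕ.≤? suc n
... | yes _ = ℕ.≤-<-trans (isqrt-upper n) 
  (ℕ.*-mono-< (ℕ.n<1+n (suc (isqrt n))) (ℕ.n<1+n (suc (isqrt n))))
... | no ¬le = ℕ.≰⇒> ¬le

scaled : ℚ → ℕ → ℕ
scaled q n = (ℤ.∣ ↥ q ∣ ℕ.* (suc n ℕ.* suc n)) ℕ./ ↧ₙ q

private
  toℚᵘ-square : ∀ k n → toℚᵘ ((+ k ℚ./ suc n) * (+ k ℚ./ suc n)) ℚᵘ.≃
                        mkℚᵘ (+ k) n ℚᵘ.* mkℚᵘ (+ k) n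
  toℚᵘ-square k n = ℚᵘ.≃-trans (toℚᵘ-homo-* (+ k ℚ./ suc n) (+ k ℚ./ suc n))
    (ℚᵘ.*-cong (toℚᵘ-fromℚᵘ (mkℚᵘ (+ k) n)) (toℚᵘ-fromℚᵘ (mkℚᵘ (+ k) n)))

opaque
  unfolding unitFraction

  -- The largest multiple of 1/(n+1) whose square is at most ∣q∣.
  approxSqrt : ℚ → ℕ → ℚ
  approxSqrt q n = + isqrt (scaled q n) ℚ./ suc n

  0≤approxSqrt : ∀ q n → 0ℚ ≤ approxSqrt q n
  0≤approxSqrt q n =
    nonNegative⁻¹ _ {{normalize-nonNeg (isqrt (scaled q n)) (suc n)}}

  approxSqrt-lower : ∀ q n → approxSqrt q n * approxSqrt q n ≤ ∣ q ∣
  approxSqrt-lower q@(mkℚ i d _) n =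
    toℚᵘ-cancel-≤ (ℚᵘ.≤-respˡ-≃ (ℚᵘ.≃-sym (toℚᵘ-square k n)) (ℚᵘ.*≤*
      (subst₂ ℤ._≤_ (trans (ℤ.pos-* (k ℕ.* k) (suc d)) (cong (ℤ._* + suc d) (ℤ.pos-* k k)))
                    (ℤ.pos-* ℤ.∣ i ∣ (suc n ℕ.* suc n))
        (ℤ.+≤+ (ℕ.≤-trans (ℕ.*-monoˡ-≤ (suc d) (isqrt-lower (scaled q n)))
                          (ℕ.m/n*n≤m (ℤ.∣ i ∣ ℕ.* (suc n ℕ.* suc n)) (suc d)))))))
    where
    k : ℕ
    k = isqrt (scaled q n)

  approxSqrt-upper : ∀ q n → let s = approxSqrt q n + unitFraction n in ∣ q ∣ < s * s
  approxSqrt-upper q@(mkℚ i d _) n =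
    subst (λ s → ∣ q ∣ < s * s) step
      (toℚᵘ-cancel-< (ℚᵘ.<-respʳ-≃ (ℚᵘ.≃-sym (toℚᵘ-square (suc k) n)) (ℚᵘ.*<*
        (subst₂ ℤ._<_ (ℤ.pos-* ℤ.∣ i ∣ (suc n ℕ.* suc n))
                      (trans (ℤ.pos-* (suc k ℕ.* suc k) (suc d))
                             (cong (ℤ._* + suc d) (ℤ.pos-* (suc k) (suc k))))
          (ℤ.+<+ lt)))))
    where
    k A : ℕ
    k = isqrt (scaled q n)
    A = ℤ.∣ i ∣ ℕ.* (suc n ℕ.* suc n)
    lt : A ℕ.< suc k ℕ.* suc k ℕ.* suc d
    lt = begin-strict
      A                                      ≡⟨ ℕ.m≡m%n+[m/n]*n A (suc d) ⟩
      A ℕ.% suc d ℕ.+ scaled q n ℕ.* suc d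
        <⟨ ℕ.+-monoˡ-< (scaled q n ℕ.* suc d) (ℕ.m%n<n A (suc d)) ⟩
      suc (scaled q n) ℕ.* suc d             ≤⟨ ℕ.*-monoˡ-≤ (suc d) (isqrt-upper (scaled q n)) ⟩
      suc k ℕ.* suc k ℕ.* suc d              ∎
      where open ℕ.≤-Reasoning
    step : + suc k ℚ./ suc n ≡ approxSqrt q n + unitFraction n
    step = toℚᵘ-injective (begin
      toℚᵘ (+ suc k ℚ./ suc n)               ≈⟨ toℚᵘ-fromℚᵘ (mkℚᵘ (+ suc k) n) ⟩
      mkℚᵘ (+ suc k) n                       ≈⟨ ℚᵘ.*≡* (trans (sym (ℤ.pos-* (suc k) _))
                                                  (trans (cong +_ nat) (ℤ.pos-* (k ℕ.* suc n ℕ.+ 1 ℕ.* suc n) (suc n)))) ⟩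
      mkℚᵘ (+ (k ℕ.* suc n ℕ.+ 1 ℕ.* suc n)) (n ℕ.+ n ℕ.* suc n)
        ≡⟨ cong (λ z → mkℚᵘ z (n ℕ.+ n ℕ.* suc n))
                (cong₂ ℤ._+_ (ℤ.pos-* k (suc n)) (ℤ.pos-* 1 (suc n))) ⟩
      mkℚᵘ (+ k) n ℚᵘ.+ mkℚᵘ (+ 1) n
        ≈⟨ ℚᵘ.+-cong (toℚᵘ-fromℚᵘ (mkℚᵘ (+ k) n)) (toℚᵘ-fromℚᵘ (mkℚᵘ (+ 1) n)) ⟨
      toℚᵘ (approxSqrt q n) ℚᵘ.+ toℚᵘ (unitFraction n)
        ≈⟨ toℚᵘ-homo-+ (approxSqrt q n) (unitFraction n) ⟨
      toℚᵘ (approxSqrt q n + unitFraction n) ∎)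
      where
      open ℚᵘ.≃-Reasoning
      open ℕ.+-*-Solver using () renaming (solve to solveℕ; _:=_ to _:≡_; _:+_ to _⊕_; _:*_ to _⊗_; con to conℕ)
      nat : suc k ℕ.* (suc n ℕ.* suc n) ≡ (k ℕ.* suc n ℕ.+ 1 ℕ.* suc n) ℕ.* suc n
      nat = solveℕ 2 (λ k m → (conℕ 1 ⊕ k) ⊗ (m ⊗ m) :≡ (k ⊗ m ⊕ conℕ 1 ⊗ m) ⊗ m) refl k (suc n)

sqrt-gap : ∀ {p q s t u h} → 0ℚ ≤ t → 0ℚ ≤ u → 0ℚ ≤ h → u ≤ h →
           s * s ≤ p → q < (t + u) * (t + u) → p ≤ h * h + q →
           s < t + (h + h)
sqrt-gap {p} {q} {s} {t} {u} {h} 0≤t 0≤u 0≤h u≤h s²≤p q<t² p≤ with s <? t + (h + h)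
... | yes lt = lt
... | no ¬lt = contradiction absurd (<-irrefl {s * s} refl)
  where
  open ≤-Reasoning
  t+2h≤s : t + (h + h) ≤ s
  t+2h≤s = ≮⇒≥ ¬lt
  0≤t+2h : 0ℚ ≤ t + (h + h)
  0≤t+2h = +-mono-≤ 0≤t (+-mono-≤ 0≤h 0≤h)
  0≤t+u : 0ℚ ≤ t + u
  0≤t+u = +-mono-≤ 0≤t 0≤u
  t+u≤t+h : t + u ≤ t + h
  t+u≤t+h = +-monoʳ-≤ t u≤h
  0≤rest : 0ℚ ≤ (t * h + t * h) + (h * h + h * h)
  0≤rest = +-mono-≤ (+-mono-≤ (0≤* 0≤t 0≤h) (0≤* 0≤t 0≤h))
                    (+-mono-≤ (0≤sq h) (0≤sq h))
  absurd : s * s < s * s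
  absurd = begin-strict
    s * s                           ≤⟨ s²≤p ⟩
    p                               ≤⟨ p≤ ⟩
    h * h + q                       <⟨ +-monoʳ-< (h * h) q<t² ⟩
    h * h + (t + u) * (t + u)
      ≤⟨ +-monoʳ-≤ (h * h) (*-mono-≤ 0≤t+u t+u≤t+h 0≤t+u t+u≤t+h) ⟩
    h * h + (t + h) * (t + h)       ≡⟨ +-identityʳ (h * h + (t + h) * (t + h)) ⟨
    h * h + (t + h) * (t + h) + 0ℚ
      ≤⟨ +-monoʳ-≤ (h * h + (t + h) * (t + h)) 0≤rest ⟩
    h * h + (t + h) * (t + h) + ((t * h + t * h) + (h * h + h * h))
      ≡⟨ solve 2 (λ t h → h :* h :+ (t :+ h) :* (t :+ h)
                            :+ ((t :* h :+ t :* h) :+ (h :* h :+ h :* h))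
                          := (t :+ (h :+ h)) :* (t :+ (h :+ h))) refl t h ⟩
    (t + (h + h)) * (t + (h + h))   ≤⟨ *-mono-≤ 0≤t+2h t+2h≤s 0≤t+2h t+2h≤s ⟩
    s * s                           ∎

∣p∣≤∣p-q∣+∣q∣ : ∀ p q → ∣ p ∣ ≤ ∣ p - q ∣ + ∣ q ∣
∣p∣≤∣p-q∣+∣q∣ p q = subst (λ r → ∣ r ∣ ≤ ∣ p - q ∣ + ∣ q ∣)
  (solve 2 (λ p q → (p :- q) :+ q := p) refl p q) (∣p+q∣≤∣p∣+∣q∣ (p - q) q)

<+⇒-< : a < b + c → a - b < c
<+⇒-< {a} {b} {c} lt = subst (a - b <_)
  (solve 2 (λ b c → (b :+ c) :- b := c) refl b c) (+-monoˡ-< (- b) lt)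

approxSqrt-close : ∀ p q m n {ε} → 0ℚ < ε → unitFraction n < ½ * ε →
                   ∣ p - q ∣ < (½ * ε) * (½ * ε) →
                   approxSqrt p m - approxSqrt q n < ε
approxSqrt-close p q m n {ε} 0<ε small close =
  <+⇒-< {approxSqrt p m} (subst (λ e → approxSqrt p m < approxSqrt q n + e) (½+½ ε)
    (sqrt-gap {∣ p ∣} {∣ q ∣}
      (0≤approxSqrt q n) (0≤unitFraction n) (<⇒≤ (0<½* 0<ε)) (<⇒≤ small)
      (approxSqrt-lower p m) (approxSqrt-upper q n)
      (≤-trans (∣p∣≤∣p-q∣+∣q∣ p q) (+-monoˡ-≤ ∣ q ∣ (<⇒≤ close)))))

-- `sqrtℝ x` is √∣x∣; it is only applied to sums of squares.
sqrtℝ : ℝ → ℝ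
sqrtℝ (mkℝ x cx) = mkℝ (λ n → approxSqrt (x n) n) λ ε 0<ε →
  let M , small = unitFraction-small (0<½* 0<ε)
      N , h = cx ((½ * ε) * (½ * ε)) (0<* (0<½* 0<ε) (0<½* 0<ε))
  in M ℕ.⊔ N , λ m n le le′ →
  let lm = ℕ.m⊔n≤o⇒n≤o M N le
      ln = ℕ.m⊔n≤o⇒n≤o M N le′
  in ∣∣-lub-<
       (approxSqrt-close (x m) (x n) m n 0<ε (small n (ℕ.m⊔n≤o⇒m≤o M N le′)) (h m n lm ln))
       (subst (_< ε) (solve 2 (λ a b → b :- a := :- (a :- b)) refl
                        (approxSqrt (x m) m) (approxSqrt (x n) n))
         (approxSqrt-close (x n) (x m) n m 0<ε (small m (ℕ.m⊔n≤o⇒m≤o M N le)) (h n m ln lm)))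

record ℂ : Set where
  constructor _+i_
  field
    re im : ℝ

open ℂ public

infix  4 _≃ℂ_
infixl 6 _+ℂ_ _-ℂ_
infixl 7 _*ℂ_
infix  8 -ℂ_

_≃ℂ_ : ℂ → ℂ → Set
z ≃ℂ w = re z ≃ℝ re w × im z ≃ℝ im w

0ℂ 1ℂ : ℂ
0ℂ = 0ℝ +i 0ℝ
1ℂ = 1ℝ +i 0ℝ

_+ℂ_ _*ℂ_ : ℂ → ℂ → ℂ
(a +i b) +ℂ (c +i d) = (a +ℝ c) +i (b +ℝ d)
(a +i b) *ℂ (c +i d) = (a *ℝ c +ℝ -ℝ (b *ℝ d)) +i (a *ℝ d +ℝ b *ℝ c)

-ℂ_ : ℂ → ℂ
-ℂ (a +i b) = (-ℝ a) +i (-ℝ b)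

_-ℂ_ : ℂ → ℂ → ℂ
z -ℂ w = z +ℂ -ℂ w

ℂ-rawRing : RawRing 0ℓ 0ℓ
ℂ-rawRing = record
  { Carrier = ℂ
  ; _≈_     = _≃ℂ_
  ; _+_     = _+ℂ_
  ; _*_     = _*ℂ_
  ; -_      = -ℂ_
  ; 0#      = 0ℂ
  ; 1#      = 1ℂ
  }

open import Algebra.Definitions.RawSemiring (RawRing.rawSemiring ℂ-rawRing) public
  using () renaming (_×_ to _×ℂ_; _^_ to _^ℂ_)

fromℕ : ℕ → ℂ
fromℕ n = n ×ℂ 1ℂ

normSq : ℂ → ℝ
normSq (a +i b) = a *ℝ a +ℝ b *ℝ b

∣_∣ℂ : ℂ → ℝ
∣ z ∣ℂ = sqrtℝ (normSq z)

-- Constructively, division needs ∣w∣² to be bounded away from 0.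
_≄0 : ℂ → Set
w ≄0 = 0ℝ <ℝ normSq w

_÷_[_] : (z w : ℂ) → w ≄0 → ℂ
z ÷ w@(a +i b) [ w≄0 ] = z *ℂ ((a *ℝ r) +i (-ℝ (b *ℝ r)))
  where r = recipℝ (normSq w) w≄0

infixl 7 _÷_[_]

1≄0 : 1ℂ ≄0
1≄0 = ½ , 0<½ , 0 , λ _ _ → toℚᵘ-cancel-< (ℚᵘ.*<* (ℤ.+<+ (ℕ.n<1+n _)))

*-≄0 : ∀ z w → z ≄0 → w ≄0 → (z *ℂ w) ≄0
*-≄0 (a +i b) (c +i d) (ε , 0<ε , M , hz) (δ , 0<δ , N , hw) =
  ε * δ , 0<* 0<ε 0<δ , M ℕ.⊔ N , λ n le → begin-strict
    0ℚ + ε * δ ≡⟨ +-identityˡ (ε * δ) ⟩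
    ε * δ
      <⟨ *-mono-< (<⇒≤ 0<ε) (subst (_< _) (+-identityˡ ε) (hz n (ℕ.m⊔n≤o⇒m≤o M N le)))
                  (<⇒≤ 0<δ) (subst (_< _) (+-identityˡ δ) (hw n (ℕ.m⊔n≤o⇒n≤o M N le))) ⟩
    (seq a n * seq a n + seq b n * seq b n) * (seq c n * seq c n + seq d n * seq d n)
      ≡⟨ solve 4 (λ a b c d →
           (a :* a :+ b :* b) :* (c :* c :+ d :* d) :=
           (a :* c :+ :- (b :* d)) :* (a :* c :+ :- (b :* d)) :+
           (a :* d :+ b :* c) :* (a :* d :+ b :* c)) refl
           (seq a n) (seq b n) (seq c n) (seq d n) ⟩
    seq (normSq ((a +i b) *ℂ (c +i d))) n ∎
  where open ≤-Reasoning

^-≄0 : ∀ z k → z ≄0 → (z ^ℂ k) ≄0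
^-≄0 z zero    z≄0 = 1≄0
^-≄0 z (suc k) z≄0 = *-≄0 z (z ^ℂ k) z≄0 (^-≄0 z k z≄0)

1-x-bound : ∀ {x y s u h} → 0ℚ ≤ s → 0ℚ ≤ u → u ≤ h → s + (h + h) < 1ℚ →
            x * x + y * y < (s + u) * (s + u) → h < 1ℚ - x
1-x-bound {x} {y} {s} {u} {h} 0≤s 0≤u u≤h s+2h<1 x²+y²<s² with h <? 1ℚ - x
... | yes lt = lt
... | no ¬lt = contradiction absurd (<-irrefl {x * x} refl)
  where
  open ≤-Reasoning
  0≤s+u : 0ℚ ≤ s + u
  0≤s+u = +-mono-≤ 0≤s 0≤u
  s+u≤x : s + u ≤ x
  s+u≤x = begin
    s + u                         ≤⟨ +-monoʳ-≤ s u≤h ⟩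
    s + h                         ≡⟨ solve 2 (λ s h → s :+ h := (s :+ (h :+ h)) :- h) refl s h ⟩
    s + (h + h) - h               ≤⟨ +-monoˡ-≤ (- h) (<⇒≤ s+2h<1) ⟩
    1ℚ - h                        ≤⟨ +-monoʳ-≤ 1ℚ (neg-antimono-≤ (≮⇒≥ ¬lt)) ⟩
    1ℚ - (1ℚ - x)                 ≡⟨ solve 2 (λ e x → e :- (e :- x) := x) refl 1ℚ x ⟩
    x                             ∎
  absurd : x * x < x * x
  absurd = begin-strict
    x * x                         ≡⟨ +-identityʳ (x * x) ⟨
    x * x + 0ℚ                    ≤⟨ +-monoʳ-≤ (x * x) (0≤sq y) ⟩
    x * x + y * y                 <⟨ x²+y²<s² ⟩
    (s + u) * (s + u)             ≤⟨ *-mono-≤ 0≤s+u s+u≤x 0≤s+u s+u≤x ⟩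
    x * x                         ∎

h²<1-x² : ∀ {x y h} → 0ℚ ≤ h → h < 1ℚ - x →
          0ℚ + h * h < (1ℚ - x) * (1ℚ - x) + (0ℚ - y) * (0ℚ - y)
h²<1-x² {x} {y} {h} 0≤h h<1-x = subst (_< (1ℚ - x) * (1ℚ - x) + (0ℚ - y) * (0ℚ - y))
  (+-comm (h * h) 0ℚ)
  (+-mono-<-≤ (*-mono-< 0≤h h<1-x 0≤h h<1-x) (0≤sq (0ℚ - y)))

1-x≄0 : ∀ x → ∣ x ∣ℂ <ℝ 1ℝ → (1ℂ -ℂ x) ≄0
1-x≄0 (a +i b) (ε , 0<ε , M , lt) =
  let N , small = unitFraction-small (0<½* 0<ε)
  in (½ * ε) * (½ * ε) , 0<* (0<½* 0<ε) (0<½* 0<ε) , M ℕ.⊔ N , λ n le →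
  let x = seq a n
      y = seq b n
      q = x * x + y * y
  in h²<1-x² {x} {y} (<⇒≤ (0<½* 0<ε))
       (1-x-bound {x} {y} (0≤approxSqrt q n) (0≤unitFraction n)
         (<⇒≤ (small n (ℕ.m⊔n≤o⇒n≤o M N le)))
         (subst (λ e → approxSqrt q n + e < 1ℚ) (sym (½+½ ε))
           (lt n (ℕ.m⊔n≤o⇒m≤o M N le)))
         (subst (_< (approxSqrt q n + unitFraction n) * (approxSqrt q n + unitFraction n))
           (0≤p⇒∣p∣≡p (+-mono-≤ (0≤sq x) (0≤sq y))) (approxSqrt-upper q n)))

_⟶_ : (ℕ → ℂ) → ℂ → Set
s ⟶ l = ∀ ε → 0ℝ <ℝ ε → ∃[ N ] (∀ n → N ℕ.≤ n → ∣ s n -ℂ l ∣ℂ <ℝ ε)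

∑< : ℕ → (ℕ → ℂ) → ℂ
∑< zero    f = 0ℂ
∑< (suc n) f = ∑< n f +ℂ f n

∑₁^∞_≈_ : (ℕ → ℂ) → ℂ → Set
∑₁^∞ f ≈ l = (λ N → ∑< N (f ∘ suc)) ⟶ l

infix 4 _⟶_ ∑₁^∞_≈_

stirling₂ : ℕ → ℕ → ℕ
stirling₂ zero    zero    = 1
stirling₂ zero    (suc k) = 0
stirling₂ (suc p) zero    = 0
stirling₂ (suc p) (suc k) = suc k ℕ.* stirling₂ p (suc k) ℕ.+ stirling₂ p k

ω : ℕ → ℂ → ℂ
ω p x = ∑< (suc p) λ k → fromℕ (stirling₂ p k ℕ.* k !) *ℂ x ^ℂ k

powerSum : ℕ → ℕ → ℕ
powerSum p zero    = 0
powerSum p (suc n) = powerSum p n ℕ.+ suc n ℕ.^ p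

{-# OPTIONS --safe #-}

-- With y = x/(1-x) and p > 0, counting surjections gives
-- 1ᵖ + ⋯ + nᵖ = ∑ₖ S(p,k) k! C(n+1,k+1), while ∑ₙ C(n+1,k+1) xⁿ = yᵏ/(1-x)².  In any commutative
-- ring where I = 1 + x I, the N-th partial sum plus an explicit polynomial in x and I with
-- natural coefficients equals I² ω_p(x I).  This error polynomial is majorised by its value at
-- r ≥ ∣x∣ and 1/(1-r) ≥ ∣1/(1-x)∣, which tends to 0 because u(N+1) ≤ r u(N) + v(N) with v → 0
-- forces u → 0.  The bounds are proved for Gaussian rationals, uniformly on ∣x∣ ≤ r, and hold
-- for all sufficiently late rational approximations of a complex x.

module Submission where

open import Algebra.Bundles using (CommutativeRing; CommutativeSemiring)
open import Data.Nat.Base as ℕ using (ℕ; zero; suc; _!; _>_)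
open import Data.Nat.Combinatorics using (_C_; nCk+nC[k+1]≡[n+1]C[k+1]; nC1≡n)
import Data.Nat.Properties as ℕ
import Data.Nat.Solver as ℕ
open import Defs
open import Relation.Binary.PropositionalEquality as ≡ using (_≡_; cong; cong₂)

-- Finite sums and binomial expansions

-- Stated for commutative semirings so that the same lemmas serve the counting identities in ℕ and
-- the error identity in a commutative ring.
module FiniteSum {c ℓ} (R : CommutativeSemiring c ℓ) where
  open CommutativeSemiring R hiding (zero)
  open import Algebra.Properties.CommutativeSemigroup +-commutativeSemigroup using (interchange)

  sum : ℕ → (ℕ → Carrier) → Carrier
  sum zero    f = 0#
  sum (suc n) f = sum n f + f n

  sum-cong : ∀ n {f g} → (∀ i → f i ≈ g i) → sum n f ≈ sum n g
  sum-cong zero    f≈g = refl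
  sum-cong (suc n) f≈g = +-cong (sum-cong n f≈g) (f≈g n)

  sum-0 : ∀ n {f} → (∀ i → f i ≈ 0#) → sum n f ≈ 0#
  sum-0 zero    f≈0 = refl
  sum-0 (suc n) f≈0 = trans (+-cong (sum-0 n f≈0) (f≈0 n)) (+-identityˡ 0#)

  sum-+ : ∀ n f g → sum n (λ i → f i + g i) ≈ sum n f + sum n g
  sum-+ zero    f g = sym (+-identityˡ 0#)
  sum-+ (suc n) f g = trans (+-congʳ (sum-+ n f g)) (interchange (sum n f) (sum n g) (f n) (g n))

  *-distribˡ-sum : ∀ n a f → a * sum n f ≈ sum n (λ i → a * f i)
  *-distribˡ-sum zero    a f = zeroʳ a
  *-distribˡ-sum (suc n) a f = trans (distribˡ a (sum n f) (f n)) (+-congʳ (*-distribˡ-sum n a f))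

  *-distribʳ-sum : ∀ n a f → sum n f * a ≈ sum n (λ i → f i * a)
  *-distribʳ-sum zero    a f = zeroˡ a
  *-distribʳ-sum (suc n) a f = trans (distribʳ a (sum n f) (f n)) (+-congʳ (*-distribʳ-sum n a f))

  sum-swap : ∀ m n (f : ℕ → ℕ → Carrier) → sum m (λ i → sum n (f i)) ≈ sum n (λ j → sum m (λ i → f i j))
  sum-swap zero    n f = sym (sum-0 n λ _ → refl)
  sum-swap (suc m) n f =
    trans (+-congʳ (sum-swap m n f)) (sym (sum-+ n (λ j → sum m (λ i → f i j)) (f m)))

  sum-suc : ∀ n f → sum (suc n) f ≈ f 0 + sum n (λ i → f (suc i))
  sum-suc zero    f = +-comm 0# (f 0)
  sum-suc (suc n) f = trans (+-congʳ (sum-suc n f)) (+-assoc _ _ _)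

-- Surjection numbers, powers and power sums

module ℕΣ = FiniteSum ℕ.+-*-commutativeSemiring

-- The number of maps from a p-element set onto a k-element set.
surjections : ℕ → ℕ → ℕ
surjections p k = stirling₂ p k ℕ.* k !

stirling₂-> : ∀ p k → k > p → stirling₂ p k ≡ 0
stirling₂-> zero    (suc k) _ = ≡.refl
stirling₂-> (suc p) (suc k) (ℕ.s≤s k>p)
  rewrite stirling₂-> p (suc k) (ℕ.m<n⇒m<1+n k>p) | stirling₂-> p k k>p =
    ≡.trans (ℕ.+-identityʳ _) (ℕ.*-zeroʳ k)

-- Counts pairs of a k-subset and a point: a point inside marks an element of the subset, a point
-- outside extends it to a (k+1)-subset with a marked element. The formal proof is an induction on n
-- by Pascal's rule.
n*nCk : ∀ n k → n ℕ.* (n C k) ≡ k ℕ.* (n C k) ℕ.+ suc k ℕ.* (n C suc k)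
n*nCk zero    zero    = ≡.refl
n*nCk zero    (suc k) = ≡.sym (cong₂ ℕ._+_ (ℕ.*-zeroʳ k) (ℕ.*-zeroʳ k))
n*nCk (suc n) zero    =
  ≡.trans (ℕ.*-identityʳ (suc n)) (≡.sym (≡.trans (ℕ.+-identityʳ _) (nC1≡n (suc n))))
n*nCk (suc n) (suc k)
  rewrite ≡.sym (nCk+nC[k+1]≡[n+1]C[k+1] n k) | ≡.sym (nCk+nC[k+1]≡[n+1]C[k+1] n (suc k)) = begin
    suc n ℕ.* (a ℕ.+ b)
      ≡⟨ solve 3 (λ n a b → (con 1 :+ n) :* (a :+ b) := (n :* a :+ n :* b) :+ (a :+ b)) ≡.refl n a b ⟩
    (n ℕ.* a ℕ.+ n ℕ.* b) ℕ.+ (a ℕ.+ b)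
      ≡⟨ cong (ℕ._+ (a ℕ.+ b)) (cong₂ ℕ._+_ (n*nCk n k) (n*nCk n (suc k))) ⟩
    ((k ℕ.* a ℕ.+ suc k ℕ.* b) ℕ.+ (suc k ℕ.* b ℕ.+ suc (suc k) ℕ.* c)) ℕ.+ (a ℕ.+ b)
      ≡⟨ solve 4 (λ k a b c →
           ((k :* a :+ (con 1 :+ k) :* b) :+ ((con 1 :+ k) :* b :+ (con 2 :+ k) :* c)) :+ (a :+ b) :=
           (con 1 :+ k) :* (a :+ b) :+ (con 2 :+ k) :* (b :+ c)) ≡.refl k a b c ⟩
    suc k ℕ.* (a ℕ.+ b) ℕ.+ suc (suc k) ℕ.* (b ℕ.+ c) ∎
  where
  open ≡.≡-Reasoning
  open ℕ.+-*-Solver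
  a = n C k
  b = n C suc k
  c = n C suc (suc k)

-- Maps from a p-set to an n-set, sorted by their image. In the induction on p, `n*nCk` turns the
-- factor n into the recurrence that expresses `surjections (suc p) (suc k)` as k+1 times the sum of
-- `surjections p (suc k)` and `surjections p k`.
^-surjections : ∀ p n → n ℕ.^ p ≡ ℕΣ.sum (suc p) (λ k → surjections p k ℕ.* (n C k))
^-surjections zero    n = ≡.refl
^-surjections (suc p) n = begin
  n ℕ.* n ℕ.^ p
    ≡⟨ cong (n ℕ.*_) (^-surjections p n) ⟩
  n ℕ.* ℕΣ.sum (suc p) (λ k → surjections p k ℕ.* (n C k))
    ≡⟨ ℕΣ.*-distribˡ-sum (suc p) n _ ⟩
  ℕΣ.sum (suc p) (λ k → n ℕ.* (surjections p k ℕ.* (n C k)))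
    ≡⟨ ℕΣ.sum-cong (suc p) split ⟩
  ℕΣ.sum (suc p) (λ k → f k ℕ.+ g k)
    ≡⟨ ℕΣ.sum-+ (suc p) f g ⟩
  ℕΣ.sum (suc p) f ℕ.+ ℕΣ.sum (suc p) g
    -- The sum of f is shifted by one index. Nothing is lost at either end: f 0 has the factor k =
    -- 0, and f (p+1) has the factor S(p,p+1) = 0.
    ≡⟨ cong (ℕ._+ ℕΣ.sum (suc p) g) (begin
         ℕΣ.sum (suc p) f                 ≡⟨ ℕ.+-identityʳ _ ⟨
         ℕΣ.sum (suc p) f ℕ.+ 0           ≡⟨ cong (ℕΣ.sum (suc p) f ℕ.+_) top ⟨
         ℕΣ.sum (suc (suc p)) f           ≡⟨ ℕΣ.sum-suc (suc p) f ⟩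
         f 0 ℕ.+ ℕΣ.sum (suc p) (λ k → f (suc k))
           ≡⟨ cong (ℕ._+ ℕΣ.sum (suc p) (λ k → f (suc k))) (ℕ.*-zeroʳ (surjections p 0)) ⟩
         ℕΣ.sum (suc p) (λ k → f (suc k)) ∎) ⟩
  ℕΣ.sum (suc p) (λ k → f (suc k)) ℕ.+ ℕΣ.sum (suc p) g
    ≡⟨ ℕΣ.sum-+ (suc p) (λ k → f (suc k)) g ⟨
  ℕΣ.sum (suc p) (λ k → f (suc k) ℕ.+ g k)
    ≡⟨ ℕΣ.sum-cong (suc p) merge ⟩
  ℕΣ.sum (suc p) (λ k → h (suc k))
    ≡⟨ ℕΣ.sum-suc (suc p) h ⟨
  ℕΣ.sum (suc (suc p)) h ∎
  where
  open ≡.≡-Reasoning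
  open ℕ.+-*-Solver
  f g h : ℕ → ℕ
  f k = surjections p k ℕ.* (k ℕ.* (n C k))
  g k = surjections p k ℕ.* (suc k ℕ.* (n C suc k))
  h k = surjections (suc p) k ℕ.* (n C k)

  split : ∀ k → n ℕ.* (surjections p k ℕ.* (n C k)) ≡ f k ℕ.+ g k
  split k = begin
    n ℕ.* (surjections p k ℕ.* (n C k))
      ≡⟨ solve 3 (λ n s c → n :* (s :* c) := s :* (n :* c)) ≡.refl n (surjections p k) (n C k) ⟩
    surjections p k ℕ.* (n ℕ.* (n C k))
      ≡⟨ cong (surjections p k ℕ.*_) (n*nCk n k) ⟩
    surjections p k ℕ.* (k ℕ.* (n C k) ℕ.+ suc k ℕ.* (n C suc k))
      ≡⟨ ℕ.*-distribˡ-+ (surjections p k) _ _ ⟩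
    f k ℕ.+ g k ∎

  top : f (suc p) ≡ 0
  top = cong (λ s → s ℕ.* suc p ! ℕ.* (suc p ℕ.* (n C suc p))) (stirling₂-> p (suc p) ℕ.≤-refl)

  merge : ∀ k → f (suc k) ℕ.+ g k ≡ h (suc k)
  merge k = solve 5 (λ k s t e c →
      s :* ((con 1 :+ k) :* e) :* ((con 1 :+ k) :* c) :+ t :* e :* ((con 1 :+ k) :* c) :=
      ((con 1 :+ k) :* s :+ t) :* ((con 1 :+ k) :* e) :* c)
    ≡.refl k (stirling₂ p (suc k)) (stirling₂ p k) (k !) (n C suc k)

-- Hockey-stick summation of `^-surjections`: the new term contributes C(n+1,k), which Pascal's rule
-- adds to C(n+1,k+1).
powerSum-surjections : ∀ p n → p > 0 →
  powerSum p n ≡ ℕΣ.sum (suc p) (λ k → surjections p k ℕ.* (suc n C suc k))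
-- Here p > 0 matters: the k = 0 term is S(p,0) C(1,1), which would be 1 for p = 0. The other terms
-- vanish because C(1,k+1) = 0 for k > 0.
powerSum-surjections (suc p) zero    _   = ≡.sym (ℕΣ.sum-0 (suc (suc p)) λ where
  zero    → ≡.refl
  (suc k) → ℕ.*-zeroʳ (surjections (suc p) (suc k)))
powerSum-surjections p       (suc n) p>0 = begin
  powerSum p n ℕ.+ suc n ℕ.^ p
    ≡⟨ cong₂ ℕ._+_ (powerSum-surjections p n p>0) (^-surjections p (suc n)) ⟩
  ℕΣ.sum (suc p) (λ k → surjections p k ℕ.* (suc n C suc k)) ℕ.+
  ℕΣ.sum (suc p) (λ k → surjections p k ℕ.* (suc n C k))
    ≡⟨ ℕΣ.sum-+ (suc p) _ _ ⟨
  ℕΣ.sum (suc p) (λ k → surjections p k ℕ.* (suc n C suc k) ℕ.+ surjections p k ℕ.* (suc n C k))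
    ≡⟨ ℕΣ.sum-cong (suc p) (λ k → begin
         surjections p k ℕ.* (suc n C suc k) ℕ.+ surjections p k ℕ.* (suc n C k)
           ≡⟨ ℕ.*-distribˡ-+ (surjections p k) _ _ ⟨
         surjections p k ℕ.* ((suc n C suc k) ℕ.+ (suc n C k))
           ≡⟨ cong (surjections p k ℕ.*_)
                (≡.trans (ℕ.+-comm (suc n C suc k) _) (nCk+nC[k+1]≡[n+1]C[k+1] (suc n) k)) ⟩
         surjections p k ℕ.* (suc (suc n) C suc k) ∎) ⟩
  ℕΣ.sum (suc p) (λ k → surjections p k ℕ.* (suc (suc n) C suc k)) ∎
  where open ≡.≡-Reasoning

-- The partial sums and their exact error

-- `I` plays the role of 1/(1-x), so that `x * I` is the argument of ω.
module PowerSeries {c ℓ} (R : CommutativeRing c ℓ) (x I : CommutativeRing.Carrier R) where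
  open CommutativeRing R hiding (zero)
  open import Algebra.Definitions.RawSemiring (CommutativeSemiring.rawSemiring commutativeSemiring)
    using (_×_; _^_)
  open import Algebra.Properties.Semiring.Mult semiring using (×-homo-+; ×1-homo-*; ×-congˡ)
  open import Algebra.Properties.Group +-group using () renaming (∙-cancelʳ to +-cancelʳ)
  open import Algebra.Solver.Ring.NaturalCoefficients.Default commutativeSemiring
  open import Relation.Binary.Reasoning.Setoid setoid
  open FiniteSum commutativeSemiring public

  fromNat : ℕ → Carrier
  fromNat n = n × 1#

  fromNat-homo-sum : ∀ n f → fromNat (ℕΣ.sum n f) ≈ sum n (λ i → fromNat (f i))
  fromNat-homo-sum zero    f = refl
  fromNat-homo-sum (suc n) f =
    trans (×-homo-+ 1# (ℕΣ.sum n f) (f n)) (+-congʳ (fromNat-homo-sum n f))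

  -- The general term of the series with sum xʲ/(1-x)ʲ⁺¹.
  monomial : ℕ → ℕ → Carrier
  monomial j n = fromNat (n C j) * x ^ n

  monomial-suc : ∀ j n → monomial (suc j) (suc n) ≈ x * (monomial j n + monomial (suc j) n)
  monomial-suc j n = begin
    fromNat (suc n C suc j) * (x * x ^ n)
      ≈⟨ *-congʳ (trans (×-congˡ (≡.sym (nCk+nC[k+1]≡[n+1]C[k+1] n j)))
                        (×-homo-+ 1# (n C j) (n C suc j))) ⟩
    (fromNat (n C j) + fromNat (n C suc j)) * (x * x ^ n)
      ≈⟨ solve 4 (λ a b x e → (a :+ b) :* (x :* e) := x :* (a :* e :+ b :* e)) refl
           (fromNat (n C j)) (fromNat (n C suc j)) x (x ^ n) ⟩
    x * (monomial j n + monomial (suc j) n) ∎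

  monomial-0-suc : ∀ n → monomial 0 (suc n) ≈ x * monomial 0 n
  monomial-0-suc n = solve 3 (λ a x e → a :* (x :* e) := x :* (a :* e)) refl (fromNat 1) x (x ^ n)

  monomials : ℕ → ℕ → Carrier
  monomials j N = sum N (monomial j)

  -- A finite expression for the tail of ∑ C(n,k) xⁿ from n = N on. It is free of subtraction, so it
  -- can be majorised term by term.
  remainder : ℕ → ℕ → Carrier
  remainder zero    N = I * monomial 0 N
  remainder (suc k) N = x * I * remainder k N + I * monomial (suc k) N

  coeff : ℕ → ℕ → Carrier
  coeff p k = fromNat (surjections p k)

  -- Two remainders occur for each k because C(n+1,k+1) = C(n,k) + C(n,k+1).
  tail : ℕ → ℕ → Carrier
  tail p N = sum (suc p) (λ k → coeff p k * (remainder k N + remainder (suc k) N))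

  omega : ℕ → Carrier → Carrier
  omega p y = sum (suc p) (λ k → coeff p k * y ^ k)

  -- The finite geometric series, in the shape h + t = a + x h that `solve-linear` accepts.
  monomials-0 : ∀ N → monomials 0 N + monomial 0 N ≈ 1# + x * monomials 0 N
  monomials-0 zero    = solve 1 (λ x → con 0 :+ (con 1 :+ con 0) :* con 1 := con 1 :+ x :* con 0) refl x
  monomials-0 (suc N) = begin
    monomials 0 N + monomial 0 N + monomial 0 (suc N)
      ≈⟨ +-cong (monomials-0 N) (monomial-0-suc N) ⟩
    1# + x * monomials 0 N + x * monomial 0 N
      ≈⟨ trans (+-assoc _ _ _) (+-congˡ (sym (distribˡ x _ _))) ⟩
    1# + x * monomials 0 (suc N) ∎

  -- Pascal's rule summed over n, again as a linear equation h + t = a + x h for h =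
  -- `monomials (suc j) N`.
  monomials-suc : ∀ j N →
    monomials (suc j) N + monomial (suc j) N ≈ x * monomials j N + x * monomials (suc j) N
  monomials-suc j zero    = solve 1 (λ x → con 0 :+ con 0 :* con 1 := x :* con 0 :+ x :* con 0) refl x
  monomials-suc j (suc N) = begin
    monomials (suc j) N + monomial (suc j) N + monomial (suc j) (suc N)
      ≈⟨ +-cong (monomials-suc j N) (monomial-suc j N) ⟩
    x * monomials j N + x * monomials (suc j) N + x * (monomial j N + monomial (suc j) N)
      ≈⟨ solve 5 (λ x a b c d → x :* a :+ x :* b :+ x :* (c :+ d) := x :* (a :+ c) :+ x :* (b :+ d))
           refl x (monomials j N) (monomials (suc j) N) (monomial j N) (monomial (suc j) N) ⟩
    x * monomials j (suc N) + x * monomials (suc j) (suc N) ∎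

  -- The hypothesis is (1-x) I = 1 written without subtraction.
  module _ (I≈1+xI : I ≈ 1# + x * I) where

    I*-unfold : ∀ a → I * a ≈ a + x * (I * a)
    I*-unfold a = begin
      I * a              ≈⟨ *-congʳ I≈1+xI ⟩
      (1# + x * I) * a   ≈⟨ distribʳ a 1# (x * I) ⟩
      1# * a + x * I * a ≈⟨ +-cong (*-identityˡ a) (*-assoc x I a) ⟩
      a + x * (I * a)    ∎

    -- Multiplies (1-x) h + t = a by I. Adding x I h to both sides and cancelling it at the end
    -- keeps the computation within the semiring operations.
    solve-linear : ∀ {h t a} → h + t ≈ a + x * h → h + I * t ≈ I * a
    solve-linear {h} {t} {a} eq = +-cancelʳ (x * I * h) _ _ (begin
      h + I * t + x * I * h
        ≈⟨ solve 4 (λ h t x I → h :+ I :* t :+ x :* I :* h := h :+ x :* (I :* h) :+ I :* t)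
             refl h t x I ⟩
      h + x * (I * h) + I * t     ≈⟨ +-congʳ (I*-unfold h) ⟨
      I * h + I * t               ≈⟨ distribˡ I h t ⟨
      I * (h + t)                 ≈⟨ *-congˡ eq ⟩
      I * (a + x * h)
        ≈⟨ solve 4 (λ h a x I → I :* (a :+ x :* h) := I :* a :+ x :* I :* h) refl h a x I ⟩
      I * a + x * I * h           ∎)

    -- Induction on k: `solve-linear` turns Pascal's rule into one more factor `x * I`, and the
    -- recursion of `remainder` follows the same step.
    monomials-limit : ∀ k N → monomials k N + remainder k N ≈ I * (x * I) ^ k
    monomials-limit zero    N = solve-linear (monomials-0 N)
    monomials-limit (suc k) N = begin
      monomials (suc k) N + (x * I * remainder k N + I * monomial (suc k) N)
        ≈⟨ solve 3 (λ a b c → a :+ (b :+ c) := a :+ c :+ b) refl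
             (monomials (suc k) N) (x * I * remainder k N) (I * monomial (suc k) N) ⟩
      monomials (suc k) N + I * monomial (suc k) N + x * I * remainder k N
        ≈⟨ +-congʳ (solve-linear (monomials-suc k N)) ⟩
      I * (x * monomials k N) + x * I * remainder k N
        ≈⟨ solve 4 (λ x I a b → I :* (x :* a) :+ x :* I :* b := x :* I :* (a :+ b)) refl
             x I (monomials k N) (remainder k N) ⟩
      x * I * (monomials k N + remainder k N)
        ≈⟨ *-congˡ (monomials-limit k N) ⟩
      x * I * (I * (x * I) ^ k)
        ≈⟨ solve 3 (λ y I e → y :* (I :* e) := I :* (y :* e)) refl (x * I) I ((x * I) ^ k) ⟩
      I * (x * I) ^ suc k ∎

    private
      shifted : ∀ k N →
        sum N (λ n → fromNat (suc n C suc k) * x ^ n) ≈ monomials k N + monomials (suc k) N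
      shifted k N = trans (sum-cong N λ n → begin
          fromNat (suc n C suc k) * x ^ n
            ≈⟨ *-congʳ (trans (×-congˡ (≡.sym (nCk+nC[k+1]≡[n+1]C[k+1] n k)))
                              (×-homo-+ 1# (n C k) (n C suc k))) ⟩
          (fromNat (n C k) + fromNat (n C suc k)) * x ^ n
            ≈⟨ distribʳ _ _ _ ⟩
          monomial k n + monomial (suc k) n ∎)
        (sum-+ N (monomial k) (monomial (suc k)))

      expand : ∀ p → p > 0 → ∀ n → fromNat (powerSum p n) * x ^ n ≈
               sum (suc p) (λ k → coeff p k * (fromNat (suc n C suc k) * x ^ n))
      expand p p>0 n = begin
        fromNat (powerSum p n) * x ^ n
          ≈⟨ *-congʳ (trans (×-congˡ (powerSum-surjections p n p>0))
                            (fromNat-homo-sum (suc p) _)) ⟩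
        sum (suc p) (λ k → fromNat (surjections p k ℕ.* (suc n C suc k))) * x ^ n
          ≈⟨ *-distribʳ-sum (suc p) (x ^ n) _ ⟩
        sum (suc p) (λ k → fromNat (surjections p k ℕ.* (suc n C suc k)) * x ^ n)
          ≈⟨ sum-cong (suc p) (λ k → trans (*-congʳ (×1-homo-* (surjections p k) (suc n C suc k)))
                                           (*-assoc _ _ _)) ⟩
        sum (suc p) (λ k → coeff p k * (fromNat (suc n C suc k) * x ^ n)) ∎

      partialSum : ∀ p → p > 0 → ∀ N → sum N (λ n → fromNat (powerSum p n) * x ^ n) ≈
                   sum (suc p) (λ k → coeff p k * (monomials k N + monomials (suc k) N))
      partialSum p p>0 N = begin
        sum N (λ n → fromNat (powerSum p n) * x ^ n)
          ≈⟨ sum-cong N (expand p p>0) ⟩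
        sum N (λ n → sum (suc p) (λ k → coeff p k * (fromNat (suc n C suc k) * x ^ n)))
          ≈⟨ sum-swap N (suc p) _ ⟩
        sum (suc p) (λ k → sum N (λ n → coeff p k * (fromNat (suc n C suc k) * x ^ n)))
          ≈⟨ sum-cong (suc p) (λ k → trans (sym (*-distribˡ-sum N (coeff p k) _))
                                           (*-congˡ (shifted k N))) ⟩
        sum (suc p) (λ k → coeff p k * (monomials k N + monomials (suc k) N)) ∎

      -- With y = x I, the limits for k and k+1 add up to c I yᵏ (1 + y), and 1 + y = I supplies the
      -- second factor I.
      limitTerm : ∀ c k N →
        c * (monomials k N + monomials (suc k) N) + c * (remainder k N + remainder (suc k) N) ≈
        I * I * (c * (x * I) ^ k)
      limitTerm c k N = begin
        c * (monomials k N + monomials (suc k) N) + c * (remainder k N + remainder (suc k) N)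
          ≈⟨ solve 5 (λ c a b a′ b′ → c :* (a :+ b) :+ c :* (a′ :+ b′) := c :* ((a :+ a′) :+ (b :+ b′)))
               refl c (monomials k N) (monomials (suc k) N) (remainder k N) (remainder (suc k) N) ⟩
        c * ((monomials k N + remainder k N) + (monomials (suc k) N + remainder (suc k) N))
          ≈⟨ *-congˡ (+-cong (monomials-limit k N) (monomials-limit (suc k) N)) ⟩
        c * (I * (x * I) ^ k + I * (x * I * (x * I) ^ k))
          ≈⟨ solve 4 (λ c I x e → c :* (I :* e :+ I :* (x :* I :* e)) :=
                            I :* (c :* e) :+ x :* (I :* (I :* (c :* e))))
               refl c I x ((x * I) ^ k) ⟩
        I * (c * (x * I) ^ k) + x * (I * (I * (c * (x * I) ^ k)))
          ≈⟨ I*-unfold (I * (c * (x * I) ^ k)) ⟨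
        I * (I * (c * (x * I) ^ k))
          ≈⟨ *-assoc I I _ ⟨
        I * I * (c * (x * I) ^ k) ∎

    partialSum+tail : ∀ p → p > 0 → ∀ N →
      sum N (λ n → fromNat (powerSum p (suc n)) * x ^ suc n) + tail p (suc N) ≈
      I * I * omega p (x * I)
    partialSum+tail p p>0 N = begin
      sum N (λ n → fromNat (powerSum p (suc n)) * x ^ suc n) + tail p (suc N)
        -- The series starts at n = 1. Its vanishing term at n = 0 is put in front, which gives N+1
        -- terms from 0 and explains the index of `tail`.
        ≈⟨ +-congʳ (+-identityˡ _) ⟨
      0# + sum N (λ n → fromNat (powerSum p (suc n)) * x ^ suc n) + tail p (suc N)
        ≈⟨ +-congʳ (+-congʳ (zeroˡ _)) ⟨
      fromNat (powerSum p 0) * x ^ 0 + sum N (λ n → fromNat (powerSum p (suc n)) * x ^ suc n) + tail p (suc N)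
        ≈⟨ +-congʳ (sum-suc N _) ⟨
      sum (suc N) (λ n → fromNat (powerSum p n) * x ^ n) + tail p (suc N)
        ≈⟨ +-congʳ (partialSum p p>0 (suc N)) ⟩
      sum (suc p) (λ k → coeff p k * (monomials k (suc N) + monomials (suc k) (suc N))) + tail p (suc N)
        ≈⟨ sum-+ (suc p) _ _ ⟨
      sum (suc p) (λ k → coeff p k * (monomials k (suc N) + monomials (suc k) (suc N)) +
                         coeff p k * (remainder k (suc N) + remainder (suc k) (suc N)))
        ≈⟨ sum-cong (suc p) (λ k → limitTerm (coeff p k) k (suc N)) ⟩
      sum (suc p) (λ k → I * I * (coeff p k * (x * I) ^ k))
        ≈⟨ *-distribˡ-sum (suc p) (I * I) _ ⟨
      I * I * omega p (x * I) ∎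

-- Null sequences of rationals

open import Algebra.Structures using (IsCommutativeRing)
open import Data.Integer.Base as ℤ using (+_)
import Data.Integer.Solver as ℤ
open import Data.Product.Base using (∃-syntax; _×_; _,_; proj₁; proj₂)
open import Data.Rational.Base as ℚ
  using (ℚ; 0ℚ; 1ℚ; ½; _+_; _*_; _-_; -_; _≤_; _<_; ∣_∣; toℚᵘ)
open import Data.Rational.Properties
open import Data.Rational.Solver using (module +-*-Solver)
open import Data.Rational.Unnormalised.Base as ℚᵘ using (mkℚᵘ)
import Data.Rational.Unnormalised.Properties as ℚᵘ
open import Data.Sum.Base using (inj₁; inj₂)
open import Function.Base using (_∘_)
open import Level using (0ℓ)
open import Relation.Nullary using (yes; no; contradiction)
open ≡ using (refl; sym; trans; subst; isEquivalence; module ≡-Reasoning)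

open +-*-Solver using (solve; _:=_; _:+_; _:*_; _:-_; :-_; con)
open import Algebra.Definitions.RawSemiring
  (CommutativeSemiring.rawSemiring (CommutativeRing.commutativeSemiring +-*-commutativeRing))
  using (_^_) renaming (_×_ to _×ℚ_)

a*a≤b*b⇒a≤b : ∀ {a b} → 0ℚ ≤ b → a * a ≤ b * b → a ≤ b
a*a≤b*b⇒a≤b {a} {b} 0≤b a²≤b² with b <? a
... | no  b≮a = ≮⇒≥ b≮a
... | yes b<a = contradiction (<-≤-trans (*-mono-< 0≤b b<a 0≤b b<a) a²≤b²) (<-irrefl {b * b} refl)

0<- : ∀ {a b} → a < b → 0ℚ < b - a
0<- {a} {b} a<b = subst (_< b - a) (+-inverseʳ a) (+-monoˡ-< (- a) a<b)

-- Reduces an inequality to a polynomial identity for the solver and the sign of the difference.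
+⇒≤ : ∀ {a b c} → a + c ≡ b → 0ℚ ≤ c → a ≤ b
+⇒≤ {a} {b} {c} a+c≡b 0≤c = begin
  a      ≡⟨ +-identityʳ a ⟨
  a + 0ℚ ≤⟨ +-monoʳ-≤ a 0≤c ⟩
  a + c  ≡⟨ a+c≡b ⟩
  b      ∎
  where open ≤-Reasoning

0≤×1 : ∀ n → 0ℚ ≤ n ×ℚ 1ℚ
0≤×1 zero    = ≤-refl
0≤×1 (suc n) = +-mono-≤ (<⇒≤ 0<1) (0≤×1 n)

0≤^ : ∀ {r} → 0ℚ ≤ r → ∀ n → 0ℚ ≤ r ^ n
0≤^ 0≤r zero    = <⇒≤ 0<1
0≤^ 0≤r (suc n) = 0≤* 0≤r (0≤^ 0≤r n)

opaque
  unfolding unitFraction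

  toℚᵘ-×1 : ∀ n → toℚᵘ (n ×ℚ 1ℚ) ℚᵘ.≃ mkℚᵘ (+ n) 0
  toℚᵘ-×1 zero    = ℚᵘ.≃-refl
  toℚᵘ-×1 (suc n) = begin
    toℚᵘ (1ℚ + n ×ℚ 1ℚ)            ≈⟨ toℚᵘ-homo-+ 1ℚ (n ×ℚ 1ℚ) ⟩
    toℚᵘ 1ℚ ℚᵘ.+ toℚᵘ (n ×ℚ 1ℚ)    ≈⟨ ℚᵘ.+-congʳ (toℚᵘ 1ℚ) (toℚᵘ-×1 n) ⟩
    mkℚᵘ (+ 1) 0 ℚᵘ.+ mkℚᵘ (+ n) 0
      ≈⟨ ℚᵘ.*≡* (solveℤ 1 (λ n → (one ⊹ n ⊛ one) ⊛ one ≔ (one ⊹ n) ⊛ one) refl (+ n)) ⟩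
    mkℚᵘ (+ suc n) 0               ∎
    where
    open ℚᵘ.≃-Reasoning
    open ℤ.+-*-Solver using (Polynomial)
      renaming (solve to solveℤ; con to conℤ; _:+_ to _⊹_; _:*_ to _⊛_; _:=_ to _≔_)
    one : ∀ {m} → Polynomial m
    one = conℤ (+ 1)

  unitFraction-inverse : ∀ n → (suc n ×ℚ 1ℚ) * unitFraction n ≡ 1ℚ
  unitFraction-inverse n = toℚᵘ-injective (begin
    toℚᵘ ((suc n ×ℚ 1ℚ) * unitFraction n)          ≈⟨ toℚᵘ-homo-* (suc n ×ℚ 1ℚ) (unitFraction n) ⟩
    toℚᵘ (suc n ×ℚ 1ℚ) ℚᵘ.* toℚᵘ (unitFraction n)
      ≈⟨ ℚᵘ.*-cong (toℚᵘ-×1 (suc n)) (toℚᵘ-fromℚᵘ (mkℚᵘ (+ 1) n)) ⟩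
    mkℚᵘ (+ suc n) 0 ℚᵘ.* mkℚᵘ (+ 1) n
      ≈⟨ ℚᵘ.*-inverseʳ (mkℚᵘ (+ suc n) 0) ⟩
    toℚᵘ 1ℚ                                        ∎)
    where open ℚᵘ.≃-Reasoning

-- For r < 1 this is rⁿ ≤ 1/(1 + n(1-r)), cleared of its denominator. With d = 1-r, the induction
-- step rests on r (1 + (n+1) d) = 1 + n d - (n+1) d².
bernoulli : ∀ {r} → 0ℚ ≤ r → ∀ n → r ^ n * (1ℚ + n ×ℚ 1ℚ * (1ℚ - r)) ≤ 1ℚ
bernoulli {r} 0≤r zero    = ≤-reflexive
  (solve 1 (λ d → con 1ℚ :* (con 1ℚ :+ con 0ℚ :* d) := con 1ℚ) refl (1ℚ - r))
bernoulli {r} 0≤r (suc n) = begin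
  r * r ^ n * (1ℚ + (1ℚ + k) * (1ℚ - r))
    ≡⟨ solve 3 (λ r p t → r :* p :* t := p :* (r :* t)) refl r (r ^ n) (1ℚ + (1ℚ + k) * (1ℚ - r)) ⟩
  r ^ n * (r * (1ℚ + (1ℚ + k) * (1ℚ - r)))
    ≤⟨ *-monoˡ-≤-nonNeg (r ^ n) {{ℚ.nonNegative (0≤^ 0≤r n)}}
         (+⇒≤ (solve 2 (λ r k → r :* (con 1ℚ :+ (con 1ℚ :+ k) :* (con 1ℚ :- r))
                                  :+ (con 1ℚ :- r) :* (con 1ℚ :- r) :* (con 1ℚ :+ k)
                                := con 1ℚ :+ k :* (con 1ℚ :- r)) refl r k)
              (0≤* (0≤sq (1ℚ - r)) (0≤×1 (suc n)))) ⟩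
  r ^ n * (1ℚ + k * (1ℚ - r))
    ≤⟨ bernoulli 0≤r n ⟩
  1ℚ ∎
  where
  open ≤-Reasoning
  k = n ×ℚ 1ℚ

-- Compares geometric decay with 1/(n+1), whose smallness is already known. `bernoulli` applies once
-- (n+1)(1-r) is weakened to 1 + n(1-r).
^≤unitFraction : ∀ {r} → 0ℚ ≤ r → ∀ n → (1ℚ - r) * r ^ n ≤ unitFraction n
^≤unitFraction {r} 0≤r n = begin
  (1ℚ - r) * r ^ n
    ≡⟨ *-identityʳ _ ⟨
  (1ℚ - r) * r ^ n * 1ℚ
    ≡⟨ cong ((1ℚ - r) * r ^ n *_) (unitFraction-inverse n) ⟨
  (1ℚ - r) * r ^ n * ((1ℚ + k) * u)
    ≡⟨ solve 4 (λ d p k u → d :* p :* ((con 1ℚ :+ k) :* u) := u :* (p :* (d :+ k :* d))) refl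
         (1ℚ - r) (r ^ n) k u ⟩
  u * (r ^ n * ((1ℚ - r) + k * (1ℚ - r)))
    ≤⟨ *-monoˡ-≤-nonNeg u {{ℚ.nonNegative (0≤unitFraction n)}}
         (*-monoˡ-≤-nonNeg (r ^ n) {{ℚ.nonNegative (0≤^ 0≤r n)}}
           (+-monoˡ-≤ (k * (1ℚ - r))
             (+⇒≤ {1ℚ - r} {1ℚ} (solve 1 (λ r → con 1ℚ :- r :+ r := con 1ℚ) refl r) 0≤r))) ⟩
  u * (r ^ n * (1ℚ + k * (1ℚ - r)))
    ≤⟨ *-monoˡ-≤-nonNeg u {{ℚ.nonNegative (0≤unitFraction n)}} (bernoulli 0≤r n) ⟩
  u * 1ℚ
    ≡⟨ *-identityʳ u ⟩
  u ∎
  where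
  open ≤-Reasoning
  k = n ×ℚ 1ℚ
  u = unitFraction n

-- One-sided: meant for sequences of non-negative bounds.
Vanishes : (ℕ → ℚ) → Set
Vanishes u = ∀ ε → 0ℚ < ε → ∃[ N ] (∀ n → N ℕ.≤ n → u n < ε)

vanishes-^ : ∀ {r} → 0ℚ ≤ r → r < 1ℚ → Vanishes (r ^_)
vanishes-^ {r} 0≤r r<1 ε 0<ε =
  let N , small = unitFraction-small (0<* (0<- r<1) 0<ε)
  in N , λ n N≤n → *-cancelˡ-<-nonNeg (1ℚ - r) {{ℚ.nonNegative (<⇒≤ (0<- r<1))}}
       (≤-<-trans (^≤unitFraction 0≤r n) (small n N≤n))

vanishes-0 : Vanishes (λ _ → 0ℚ)
vanishes-0 ε 0<ε = 0 , λ _ _ → 0<ε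

vanishes-+ : ∀ {u v} → Vanishes u → Vanishes v → Vanishes (λ n → u n + v n)
vanishes-+ {u} {v} u→0 v→0 ε 0<ε =
  let M , hu = u→0 (½ * ε) (0<½* 0<ε)
      N , hv = v→0 (½ * ε) (0<½* 0<ε)
  in M ℕ.⊔ N , λ n le → subst (u n + v n <_) (½+½ ε)
       (+-mono-< (hu n (ℕ.m⊔n≤o⇒m≤o M N le)) (hv n (ℕ.m⊔n≤o⇒n≤o M N le)))

vanishes-* : ∀ {c u} → 0ℚ ≤ c → Vanishes u → Vanishes (λ n → c * u n)
vanishes-* {c} {u} 0≤c u→0 ε 0<ε =
  -- Dividing by c + 1 instead of c covers c = 0.
  let δ , 0<δ , eq = divide (+-mono-≤-< 0≤c 0<1) 0<ε
      N , h = u→0 δ 0<δ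
  in N , λ n le → begin-strict
    c * u n        ≤⟨ *-monoˡ-≤-nonNeg c {{ℚ.nonNegative 0≤c}} (<⇒≤ (h n le)) ⟩
    c * δ          ≡⟨ +-identityʳ (c * δ) ⟨
    c * δ + 0ℚ     <⟨ +-monoʳ-< (c * δ) 0<δ ⟩
    c * δ + δ      ≡⟨ solve 2 (λ c δ → c :* δ :+ δ := (c :+ con 1ℚ) :* δ) refl c δ ⟩
    (c + 1ℚ) * δ   ≡⟨ eq ⟩
    ε              ∎
  where open ≤-Reasoning

-- From some M on, v stays below (1-r) η. Since η is the fixed point of t ↦ r t + (1-r) η, the
-- excess of u over η is bounded by a geometric sequence.
vanishes-recurrence : ∀ {r u v} → 0ℚ ≤ r → r < 1ℚ →
  (∀ n → u (suc n) ≤ r * u n + v n) → Vanishes v → Vanishes u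
vanishes-recurrence {r} {u} {v} 0≤r r<1 step v→0 ε 0<ε =
  let δ , 0<δ , Bδ = divide 0<B 0<η
      K , rᵏ<δ = vanishes-^ 0≤r r<1 δ 0<δ
  in K ℕ.+ M , λ n le → begin-strict
    u n                     ≡⟨ cong u (ℕ.m∸n+n≡m (ℕ.m+n≤o⇒n≤o K le)) ⟨
    u (n ℕ.∸ M ℕ.+ M)       ≤⟨ decay (n ℕ.∸ M) ⟩
    η + B * r ^ (n ℕ.∸ M)
      <⟨ +-monoʳ-< η (*-monoʳ-<-pos B {{ℚ.positive 0<B}} (rᵏ<δ (n ℕ.∸ M) (ℕ.m+n≤o⇒m≤o∸n K le))) ⟩
    η + B * δ               ≡⟨ cong (_+_ η) Bδ ⟩
    η + η                   ≡⟨ ½+½ ε ⟩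
    ε                       ∎
  where
  open ≤-Reasoning
  η = ½ * ε
  0<η = 0<½* 0<ε
  tail-small = v→0 ((1ℚ - r) * η) (0<* (0<- r<1) 0<η)
  M = proj₁ tail-small
  -- The summand 1 makes B positive, so that η can be divided by it.
  B = ∣ u M ∣ + 1ℚ
  0<B : 0ℚ < B
  0<B = +-mono-≤-< (0≤∣p∣ (u M)) 0<1
  decay : ∀ k → u (k ℕ.+ M) ≤ η + B * r ^ k
  decay zero    = begin
    u M               ≤⟨ p≤∣p∣ (u M) ⟩
    ∣ u M ∣           ≤⟨ +⇒≤ (solve 2 (λ η a → a :+ (η :+ con 1ℚ) := η :+ (a :+ con 1ℚ) :* con 1ℚ) refl η ∣ u M ∣)
                             (+-mono-≤ (<⇒≤ 0<η) (<⇒≤ 0<1)) ⟩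
    η + B * 1ℚ        ∎
    where
    p≤∣p∣ : ∀ p → p ≤ ∣ p ∣
    p≤∣p∣ p with ≤-total 0ℚ p
    ... | inj₁ 0≤p = ≤-reflexive (sym (0≤p⇒∣p∣≡p 0≤p))
    ... | inj₂ p≤0 = ≤-trans p≤0 (0≤∣p∣ p)
  decay (suc k) = begin
    u (suc k ℕ.+ M)                       ≤⟨ step (k ℕ.+ M) ⟩
    r * u (k ℕ.+ M) + v (k ℕ.+ M)
      ≤⟨ +-mono-≤ (*-monoˡ-≤-nonNeg r {{ℚ.nonNegative 0≤r}} (decay k))
                  (<⇒≤ (proj₂ tail-small (k ℕ.+ M) (ℕ.m≤n+m M k))) ⟩
    r * (η + B * r ^ k) + (1ℚ - r) * η
      ≡⟨ solve 4 (λ r η B p → r :* (η :+ B :* p) :+ (con 1ℚ :- r) :* η := η :+ B :* (r :* p)) refl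
           r η B (r ^ k) ⟩
    η + B * r ^ suc k                     ∎

-- Majorants of the error polynomial

module Majorant {r s : ℚ} (0≤r : 0ℚ ≤ r) (r<1 : r < 1ℚ) (0≤s : 0ℚ ≤ s) where
  open PowerSeries +-*-commutativeRing r s

  -- Induction on j: `monomial-suc` is the recurrence of `vanishes-recurrence`, with r times the
  -- previous null sequence as inhomogeneous term.
  vanishes-monomial : ∀ j → Vanishes (monomial j)
  vanishes-monomial zero    = vanishes-recurrence 0≤r r<1
    (λ n → ≤-reflexive (trans (monomial-0-suc n) (sym (+-identityʳ _)))) vanishes-0
  vanishes-monomial (suc j) = vanishes-recurrence 0≤r r<1
    (λ n → ≤-reflexive (trans (monomial-suc j n)
             (solve 3 (λ r a b → r :* (a :+ b) := r :* b :+ r :* a) refl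
                r (monomial j n) (monomial (suc j) n))))
    (vanishes-* 0≤r (vanishes-monomial j))

  vanishes-remainder : ∀ k → Vanishes (remainder k)
  vanishes-remainder zero    = vanishes-* 0≤s (vanishes-monomial 0)
  vanishes-remainder (suc k) =
    vanishes-+ (vanishes-* (0≤* 0≤r 0≤s) (vanishes-remainder k))
               (vanishes-* 0≤s (vanishes-monomial (suc k)))

  vanishes-sum : ∀ m {f : ℕ → ℕ → ℚ} → (∀ k → Vanishes (f k)) → Vanishes (λ N → sum m (λ k → f k N))
  vanishes-sum zero    f→0 = vanishes-0
  vanishes-sum (suc m) f→0 = vanishes-+ (vanishes-sum m f→0) (f→0 m)

  vanishes-tail : ∀ p → Vanishes (tail p)
  vanishes-tail p = vanishes-sum (suc p) λ k →
    vanishes-* (0≤×1 (surjections p k)) (vanishes-+ (vanishes-remainder k) (vanishes-remainder (suc k)))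

-- The tail is built from x, I, 0 and 1 by sums and products alone, so any relation compatible with
-- these passes from the arguments to the tail.
module Majorization
  {a b ℓ₁ ℓ₂} (A : CommutativeRing a ℓ₁) (B : CommutativeRing b ℓ₂) where

  private
    module A = CommutativeRing A
    module B = CommutativeRing B
  open import Algebra.Definitions.RawSemiring (CommutativeSemiring.rawSemiring A.commutativeSemiring)
    using () renaming (_^_ to _^A_)
  open import Algebra.Definitions.RawSemiring (CommutativeSemiring.rawSemiring B.commutativeSemiring)
    using () renaming (_^_ to _^B_)

  module _ {ℓ} (_≼_ : A.Carrier → B.Carrier → Set ℓ)
    (0-≼ : A.0# ≼ B.0#) (1-≼ : A.1# ≼ B.1#)
    (+-≼ : ∀ {z w s t} → z ≼ s → w ≼ t → (z A.+ w) ≼ (s B.+ t))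
    (*-≼ : ∀ {z w s t} → z ≼ s → w ≼ t → (z A.* w) ≼ (s B.* t))
    {x I r s} (x≼r : x ≼ r) (I≼s : I ≼ s)
    where

    private
      module P = PowerSeries A x I
      module Q = PowerSeries B r s

    fromNat-≼ : ∀ n → P.fromNat n ≼ Q.fromNat n
    fromNat-≼ zero    = 0-≼
    fromNat-≼ (suc n) = +-≼ 1-≼ (fromNat-≼ n)

    ^-≼ : ∀ n → (x ^A n) ≼ (r ^B n)
    ^-≼ zero    = 1-≼
    ^-≼ (suc n) = *-≼ x≼r (^-≼ n)

    monomial-≼ : ∀ j n → P.monomial j n ≼ Q.monomial j n
    monomial-≼ j n = *-≼ (fromNat-≼ (n C j)) (^-≼ n)

    remainder-≼ : ∀ k N → P.remainder k N ≼ Q.remainder k N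
    remainder-≼ zero    N = *-≼ I≼s (monomial-≼ 0 N)
    remainder-≼ (suc k) N =
      +-≼ (*-≼ (*-≼ x≼r I≼s) (remainder-≼ k N)) (*-≼ I≼s (monomial-≼ (suc k) N))

    sum-≼ : ∀ m {f g} → (∀ k → f k ≼ g k) → P.sum m f ≼ Q.sum m g
    sum-≼ zero    f≼g = 0-≼
    sum-≼ (suc m) f≼g = +-≼ (sum-≼ m f≼g) (f≼g m)

    tail-≼ : ∀ p N → P.tail p N ≼ Q.tail p N
    tail-≼ p N = sum-≼ (suc p) λ k →
      *-≼ (fromNat-≼ (surjections p k)) (+-≼ (remainder-≼ k N) (remainder-≼ (suc k) N))

-- Gaussian rationals

record ℚ[i] : Set where
  constructor _+iℚ_
  field
    Re Im : ℚ

open ℚ[i]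

infixl 6 _⊕_
infixl 7 _⊗_
infix  8 ⊖_
infix  4 _≼_

0ⁱ 1ⁱ : ℚ[i]
0ⁱ = 0ℚ +iℚ 0ℚ
1ⁱ = 1ℚ +iℚ 0ℚ

norm : ℚ[i] → ℚ
norm z = Re z * Re z + Im z * Im z

-- Opaque so that equations are compared by their ring structure rather than componentwise.
opaque
  _⊕_ _⊗_ : ℚ[i] → ℚ[i] → ℚ[i]
  z ⊕ w = (Re z + Re w) +iℚ (Im z + Im w)
  z ⊗ w = (Re z * Re w + - (Im z * Im w)) +iℚ (Re z * Im w + Im z * Re w)

  ⊖_ : ℚ[i] → ℚ[i]
  ⊖ z = (- Re z) +iℚ (- Im z)

  -- The same formula as for division in ℂ, so that taking the n-th approximation commutes with
  -- division by definition. At 0 the default value of `recip` makes it 0.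
  inv : ℚ[i] → ℚ[i]
  inv z = (Re z * recip (norm z)) +iℚ (- (Im z * recip (norm z)))

  ℚ[i]-isCommutativeRing : IsCommutativeRing _≡_ _⊕_ _⊗_ ⊖_ 0ⁱ 1ⁱ
  ℚ[i]-isCommutativeRing = record
    { isRing = record
      { +-isAbelianGroup = record
        { isGroup = record
          { isMonoid = record
            { isSemigroup = record
              { isMagma = record { isEquivalence = isEquivalence ; ∙-cong = cong₂ _⊕_ }
              ; assoc = λ x y z → cong₂ _+iℚ_ (+-assoc (Re x) (Re y) (Re z)) (+-assoc (Im x) (Im y) (Im z))
              }
            ; identity = (λ x → cong₂ _+iℚ_ (+-identityˡ (Re x)) (+-identityˡ (Im x)))
                       , (λ x → cong₂ _+iℚ_ (+-identityʳ (Re x)) (+-identityʳ (Im x)))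
            }
          ; inverse = (λ x → cong₂ _+iℚ_ (+-inverseˡ (Re x)) (+-inverseˡ (Im x)))
                    , (λ x → cong₂ _+iℚ_ (+-inverseʳ (Re x)) (+-inverseʳ (Im x)))
          ; ⁻¹-cong = cong ⊖_
          }
        ; comm = λ x y → cong₂ _+iℚ_ (+-comm (Re x) (Re y)) (+-comm (Im x) (Im y))
        }
      ; *-cong = cong₂ _⊗_
      ; *-assoc = ⊗-assoc
      ; *-identity = ⊗-identityˡ , λ x → trans (⊗-comm x 1ⁱ) (⊗-identityˡ x)
      ; distrib = ⊗-distribˡ , λ x y z →
          trans (⊗-comm (y ⊕ z) x) (trans (⊗-distribˡ x y z) (cong₂ _⊕_ (⊗-comm x y) (⊗-comm x z)))
      }
    ; *-comm = ⊗-comm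
    }
    where
    ⊗-assoc : ∀ x y z → (x ⊗ y) ⊗ z ≡ x ⊗ (y ⊗ z)
    ⊗-assoc (a +iℚ b) (c +iℚ d) (e +iℚ f) = cong₂ _+iℚ_
      (solve 6 (λ a b c d e f →
         (a :* c :+ :- (b :* d)) :* e :+ :- ((a :* d :+ b :* c) :* f) :=
         a :* (c :* e :+ :- (d :* f)) :+ :- (b :* (c :* f :+ d :* e))) refl a b c d e f)
      (solve 6 (λ a b c d e f →
         (a :* c :+ :- (b :* d)) :* f :+ (a :* d :+ b :* c) :* e :=
         a :* (c :* f :+ d :* e) :+ b :* (c :* e :+ :- (d :* f))) refl a b c d e f)

    ⊗-comm : ∀ x y → x ⊗ y ≡ y ⊗ x
    ⊗-comm (a +iℚ b) (c +iℚ d) = cong₂ _+iℚ_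
      (solve 4 (λ a b c d → a :* c :+ :- (b :* d) := c :* a :+ :- (d :* b)) refl a b c d)
      (solve 4 (λ a b c d → a :* d :+ b :* c := c :* b :+ d :* a) refl a b c d)

    ⊗-identityˡ : ∀ x → 1ⁱ ⊗ x ≡ x
    ⊗-identityˡ (a +iℚ b) = cong₂ _+iℚ_
      (solve 2 (λ a b → con 1ℚ :* a :+ :- (con 0ℚ :* b) := a) refl a b)
      (solve 2 (λ a b → con 1ℚ :* b :+ con 0ℚ :* a := b) refl a b)

    ⊗-distribˡ : ∀ x y z → x ⊗ (y ⊕ z) ≡ x ⊗ y ⊕ x ⊗ z
    ⊗-distribˡ (a +iℚ b) (c +iℚ d) (e +iℚ f) = cong₂ _+iℚ_
      (solve 6 (λ a b c d e f →
         a :* (c :+ e) :+ :- (b :* (d :+ f)) :=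
         a :* c :+ :- (b :* d) :+ (a :* e :+ :- (b :* f))) refl a b c d e f)
      (solve 6 (λ a b c d e f →
         a :* (d :+ f) :+ b :* (c :+ e) :=
         a :* d :+ b :* c :+ (a :* f :+ b :* e)) refl a b c d e f)

ℚ[i]-commutativeRing : CommutativeRing 0ℓ 0ℓ
ℚ[i]-commutativeRing = record { isCommutativeRing = ℚ[i]-isCommutativeRing }

module Gaussian = CommutativeRing ℚ[i]-commutativeRing
open import Algebra.Definitions.RawSemiring
  (CommutativeSemiring.rawSemiring Gaussian.commutativeSemiring)
  using () renaming (_^_ to _^ⁱ_)

0≤norm : ∀ z → 0ℚ ≤ norm z
0≤norm z = +-mono-≤ (0≤sq (Re z)) (0≤sq (Im z))

opaque
  unfolding _⊗_

  -- The Brahmagupta-Fibonacci two-square identity.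
  norm-* : ∀ z w → norm (z ⊗ w) ≡ norm z * norm w
  norm-* (a +iℚ b) (c +iℚ d) = solve 4 (λ a b c d →
    (a :* c :+ :- (b :* d)) :* (a :* c :+ :- (b :* d)) :+ (a :* d :+ b :* c) :* (a :* d :+ b :* c) :=
    (a :* a :+ b :* b) :* (c :* c :+ d :* d)) refl a b c d

-- ∣z∣ ≤ t, expressed without square roots.
record _≼_ (z : ℚ[i]) (t : ℚ) : Set where
  constructor bound
  field
    nonNegative : 0ℚ ≤ t
    norm≤       : norm z ≤ t * t

0≼0 : 0ⁱ ≼ 0ℚ
0≼0 = bound ≤-refl ≤-refl

1≼1 : 1ⁱ ≼ 1ℚ
1≼1 = bound (<⇒≤ 0<1) ≤-refl

⊗-≼ : ∀ {z w s t} → z ≼ s → w ≼ t → z ⊗ w ≼ s * t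
⊗-≼ {z} {w} {s} {t} (bound 0≤s z≤s) (bound 0≤t w≤t) = bound (0≤* 0≤s 0≤t) (begin
  norm (z ⊗ w)      ≡⟨ norm-* z w ⟩
  norm z * norm w   ≤⟨ *-mono-≤ (0≤norm z) z≤s (0≤norm w) w≤t ⟩
  s * s * (t * t)   ≡⟨ solve 2 (λ s t → s :* s :* (t :* t) := s :* t :* (s :* t)) refl s t ⟩
  s * t * (s * t)   ∎)
  where open ≤-Reasoning

opaque
  unfolding _⊕_

  -- Cauchy–Schwarz for the cross term of ∣z + w∣².
  ⊕-≼ : ∀ {z w s t} → z ≼ s → w ≼ t → z ⊕ w ≼ s + t
  ⊕-≼ {a +iℚ b} {c +iℚ d} {s} {t} (bound 0≤s z≤s) (bound 0≤t w≤t) = bound (+-mono-≤ 0≤s 0≤t) (begin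
    (a + c) * (a + c) + (b + d) * (b + d)
      ≡⟨ solve 4 (λ a b c d →
           (a :+ c) :* (a :+ c) :+ (b :+ d) :* (b :+ d) :=
           (a :* a :+ b :* b) :+ (c :* c :+ d :* d) :+ ((a :* c :+ b :* d) :+ (a :* c :+ b :* d))) refl a b c d ⟩
    (a * a + b * b) + (c * c + d * d) + (cross + cross)
      ≤⟨ +-mono-≤ (+-mono-≤ z≤s w≤t) (+-mono-≤ cross≤st cross≤st) ⟩
    s * s + t * t + (s * t + s * t)
      ≡⟨ solve 2 (λ s t → s :* s :+ t :* t :+ (s :* t :+ s :* t) := (s :+ t) :* (s :+ t)) refl s t ⟩
    (s + t) * (s + t) ∎)
    where
    open ≤-Reasoning
    cross : ℚ
    cross = a * c + b * d
    cross≤st : cross ≤ s * t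
    cross≤st = a*a≤b*b⇒a≤b (0≤* 0≤s 0≤t) (begin
      cross * cross
        ≤⟨ +⇒≤ (solve 4 (λ a b c d →
                  (a :* c :+ b :* d) :* (a :* c :+ b :* d) :+ (a :* d :- b :* c) :* (a :* d :- b :* c) :=
                  (a :* a :+ b :* b) :* (c :* c :+ d :* d)) refl a b c d)
               (0≤sq (a * d - b * c)) ⟩
      (a * a + b * b) * (c * c + d * d)
        ≤⟨ *-mono-≤ (0≤norm (a +iℚ b)) z≤s (0≤norm (c +iℚ d)) w≤t ⟩
      s * s * (t * t)
        ≡⟨ solve 2 (λ s t → s :* s :* (t :* t) := s :* t :* (s :* t)) refl s t ⟩
      s * t * (s * t) ∎)

opaque
  unfolding _⊗_

  inv-inverse : ∀ z → 0ℚ < norm z → z ⊗ inv z ≡ 1ⁱ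
  inv-inverse (a +iℚ b) 0<n = cong₂ _+iℚ_
    (trans (solve 3 (λ a b r → a :* (a :* r) :+ :- (b :* :- (b :* r)) := (a :* a :+ b :* b) :* r) refl a b ρ)
           (recip-inverse 0<n))
    (solve 3 (λ a b r → a :* (:- (b :* r)) :+ b :* (a :* r) := con 0ℚ) refl a b ρ)
    where
    ρ : ℚ
    ρ = recip (a * a + b * b)

inv-unique : ∀ z w → 0ℚ < norm z → z ⊗ w ≡ 1ⁱ → inv z ≡ w
inv-unique z w 0<n zw≡1 = begin
  inv z             ≡⟨ Gaussian.*-identityʳ (inv z) ⟨
  inv z ⊗ 1ⁱ        ≡⟨ cong (inv z ⊗_) zw≡1 ⟨
  inv z ⊗ (z ⊗ w)   ≡⟨ Gaussian.*-assoc (inv z) z w ⟨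
  inv z ⊗ z ⊗ w     ≡⟨ cong (_⊗ w) (trans (Gaussian.*-comm (inv z) z) (inv-inverse z 0<n)) ⟩
  1ⁱ ⊗ w            ≡⟨ Gaussian.*-identityˡ w ⟩
  w                 ∎
  where open ≡-Reasoning

opaque
  unfolding _⊕_ ⊖_

  z≡z-w+w : ∀ z w → z ≡ z ⊕ ⊖ w ⊕ w
  z≡z-w+w z w = cong₂ _+iℚ_ (split (Re z) (Re w)) (split (Im z) (Im w))
    where
    split : ∀ a b → a ≡ a - b + b
    split = solve 2 (λ a b → a := a :- b :+ b) refl

  -- Applied with a partial sum z and its tail w: the distance to the limit is the size of the tail.
  norm-[z-[z+w]] : ∀ z w → norm (z ⊕ ⊖ (z ⊕ w)) ≡ norm w
  norm-[z-[z+w]] z w = solve 4 (λ a b c d →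
    (a :+ :- (a :+ c)) :* (a :+ :- (a :+ c)) :+ (b :+ :- (b :+ d)) :* (b :+ :- (b :+ d)) :=
    c :* c :+ d :* d) refl (Re z) (Im z) (Re w) (Im w)

  -- ∣1-z∣ is at least 1 - Re z, which is at least 1-r.
  norm-1- : ∀ {z r} → z ≼ r → r < 1ℚ → (1ℚ - r) * (1ℚ - r) ≤ norm (1ⁱ ⊕ ⊖ z)
  norm-1- {z} {r} z≼r r<1 = begin
    (1ℚ - r) * (1ℚ - r)
      ≤⟨ *-mono-≤ (<⇒≤ (0<- r<1)) 1-r≤ (<⇒≤ (0<- r<1)) 1-r≤ ⟩
    (1ℚ - Re z) * (1ℚ - Re z)
      ≤⟨ +⇒≤ refl (0≤sq (0ℚ - Im z)) ⟩
    norm (1ⁱ ⊕ ⊖ z) ∎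
    where
    open ≤-Reasoning
    Re≤r : Re z ≤ r
    Re≤r = a*a≤b*b⇒a≤b (_≼_.nonNegative z≼r) (≤-trans (+⇒≤ refl (0≤sq (Im z))) (_≼_.norm≤ z≼r))
    1-r≤ : 1ℚ - r ≤ 1ℚ - Re z
    1-r≤ = +-monoʳ-≤ 1ℚ (neg-antimono-≤ Re≤r)

-- Uniform error bound on a closed disc

module UniformTail {r : ℚ} (0≤r : 0ℚ ≤ r) (r<1 : r < 1ℚ) where

  -- The number 1/(1-r), which bounds ∣1/(1-x)∣ on the disc.
  s : ℚ
  s = proj₁ (divide (0<- r<1) 0<1)

  0<s : 0ℚ < s
  0<s = proj₁ (proj₂ (divide (0<- r<1) 0<1))

  [1-r]s≡1 : (1ℚ - r) * s ≡ 1ℚ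
  [1-r]s≡1 = proj₂ (proj₂ (divide (0<- r<1) 0<1))

  module _ {x : ℚ[i]} (x≼r : x ≼ r) where
    D I : ℚ[i]
    D = 1ⁱ ⊕ ⊖ x
    I = inv D

    norm-D : (1ℚ - r) * (1ℚ - r) ≤ norm D
    norm-D = norm-1- x≼r r<1

    0<norm-D : 0ℚ < norm D
    0<norm-D = <-≤-trans (0<* (0<- r<1) (0<- r<1)) norm-D

    DI≡1 : D ⊗ I ≡ 1ⁱ
    DI≡1 = inv-inverse D 0<norm-D

    I≡1+xI : I ≡ 1ⁱ ⊕ x ⊗ I
    I≡1+xI = begin
      I                        ≡⟨ Gaussian.*-identityˡ I ⟨
      1ⁱ ⊗ I                   ≡⟨ cong (_⊗ I) (z≡z-w+w 1ⁱ x) ⟩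
      (D ⊕ x) ⊗ I              ≡⟨ Gaussian.distribʳ I D x ⟩
      D ⊗ I ⊕ x ⊗ I            ≡⟨ cong (_⊕ x ⊗ I) DI≡1 ⟩
      1ⁱ ⊕ x ⊗ I               ∎
      where open ≡-Reasoning

    -- Since ∣1-x∣ ∣I∣ = 1 = (1-r) s, the lower bound 1-r on ∣1-x∣ gives the upper bound s on ∣I∣;
    -- all of this is done with squares.
    I≼s : I ≼ s
    I≼s = bound (<⇒≤ 0<s) (*-cancelˡ-≤-pos ((1ℚ - r) * (1ℚ - r)) {{ℚ.positive (0<* (0<- r<1) (0<- r<1))}} (begin
      (1ℚ - r) * (1ℚ - r) * norm I
        ≤⟨ *-monoʳ-≤-nonNeg (norm I) {{ℚ.nonNegative (0≤norm I)}} norm-D ⟩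
      norm D * norm I
        ≡⟨ norm-* D I ⟨
      norm (D ⊗ I)
        ≡⟨ cong norm DI≡1 ⟩
      norm 1ⁱ
        ≡⟨⟩
      1ℚ * 1ℚ
        ≡⟨ cong₂ _*_ [1-r]s≡1 [1-r]s≡1 ⟨
      (1ℚ - r) * s * ((1ℚ - r) * s)
        ≡⟨ solve 2 (λ d s → d :* s :* (d :* s) := d :* d :* (s :* s)) refl (1ℚ - r) s ⟩
      (1ℚ - r) * (1ℚ - r) * (s * s) ∎))
      where open ≤-Reasoning

    -- The theorem divides by a power of 1-x, while the ring identity has a product of inverses;
    -- this reconciles the two.
    inv-D² : inv (D ^ⁱ 2) ≡ I ⊗ I
    inv-D² = inv-unique (D ^ⁱ 2) (I ⊗ I)
      (subst (0ℚ <_) (sym (trans (norm-* D (D ⊗ 1ⁱ)) (cong (norm D *_) (cong norm (Gaussian.*-identityʳ D)))))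
        (0<* 0<norm-D 0<norm-D))
      (begin
        D ⊗ (D ⊗ 1ⁱ) ⊗ (I ⊗ I)   ≡⟨ cong (λ w → D ⊗ w ⊗ (I ⊗ I)) (Gaussian.*-identityʳ D) ⟩
        D ⊗ D ⊗ (I ⊗ I)          ≡⟨ interchange D D I I ⟩
        D ⊗ I ⊗ (D ⊗ I)          ≡⟨ cong₂ _⊗_ DI≡1 DI≡1 ⟩
        1ⁱ ⊗ 1ⁱ                  ≡⟨ Gaussian.*-identityˡ 1ⁱ ⟩
        1ⁱ                       ∎)
      where
      open ≡-Reasoning
      open import Algebra.Properties.CommutativeSemigroup Gaussian.*-commutativeSemigroup
        using (interchange)

    private
      module A = PowerSeries ℚ[i]-commutativeRing x I
      module B = PowerSeries +-*-commutativeRing r s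

    limit : ℕ → ℚ[i]
    limit p = 1ⁱ ⊗ inv (D ^ⁱ 2) ⊗ A.omega p (x ⊗ I)

    partialSum : ℕ → ℕ → ℚ[i]
    partialSum p N = A.sum N (λ n → A.fromNat (powerSum p (suc n)) ⊗ x ^ⁱ suc n)

    -- By the exact identity the error is minus the tail, which is majorised by its value at r and
    -- s. That value does not depend on x, so the bound is uniform on the disc.
    error-≼ : ∀ p → p > 0 → ∀ N → partialSum p N ⊕ ⊖ limit p ≼ B.tail p (suc N)
    error-≼ p p>0 N = bound 0≤T (subst (_≤ B.tail p (suc N) * B.tail p (suc N)) (sym norm≡) T≤)
      where
      S T : ℚ[i]
      S = partialSum p N
      T = A.tail p (suc N)
      S+T≡limit : S ⊕ T ≡ limit p
      S+T≡limit = trans (A.partialSum+tail I≡1+xI p p>0 N)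
        (cong (_⊗ A.omega p (x ⊗ I)) (sym (trans (Gaussian.*-identityˡ (inv (D ^ⁱ 2))) inv-D²)))
      open _≼_ (Majorization.tail-≼ ℚ[i]-commutativeRing +-*-commutativeRing _≼_
        0≼0 1≼1 ⊕-≼ ⊗-≼ x≼r I≼s p (suc N)) renaming (nonNegative to 0≤T; norm≤ to T≤)
      norm≡ : norm (S ⊕ ⊖ limit p) ≡ norm T
      norm≡ = trans (cong (λ l → norm (S ⊕ ⊖ l)) (sym S+T≡limit))
        (norm-[z-[z+w]] S T)

-- Rational approximations of complex numbers

-- Arithmetic in ℂ acts termwise on sequences, so evaluation at a fixed index respects all of its
-- operations definitionally.
at : ℕ → ℂ → ℚ[i]
at n z = seq (re z) n +iℚ seq (im z) n

opaque
  unfolding _⊕_ _⊗_ ⊖_ inv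

  at-0 : ∀ n → at n 0ℂ ≡ 0ⁱ
  at-0 n = refl

  at-1 : ∀ n → at n 1ℂ ≡ 1ⁱ
  at-1 n = refl

  -- Not obtained from a rule for `at n (z *ℂ w)`: instantiating one makes Agda compare products in
  -- ℂ, hence their Cauchy proofs, instead of rational sequences.
  at-fromℕ*^ : ∀ n c z k → at n (fromℕ c *ℂ z ^ℂ k) ≡ at n (fromℕ c) ⊗ at n (z ^ℂ k)
  at-fromℕ*^ n c z k = refl

  at-1÷* : ∀ n w w≄0 z → at n (1ℂ ÷ w [ w≄0 ] *ℂ z) ≡ 1ⁱ ⊗ inv (at n w) ⊗ at n z
  at-1÷* n w w≄0 z = refl

  at-- : ∀ n z w → at n (z -ℂ w) ≡ at n z ⊕ ⊖ at n w
  at-- n z w = refl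

  at-1- : ∀ n z → at n (1ℂ -ℂ z) ≡ 1ⁱ ⊕ ⊖ at n z
  at-1- n z = refl

  at-÷ : ∀ n z w w≄0 → at n (z ÷ w [ w≄0 ]) ≡ at n z ⊗ inv (at n w)
  at-÷ n z w w≄0 = refl

  at-^-suc : ∀ n z k → at n (z ^ℂ suc k) ≡ at n z ⊗ at n (z ^ℂ k)
  at-^-suc n z k = refl

  at-fromℕ-suc : ∀ n k → at n (fromℕ (suc k)) ≡ 1ⁱ ⊕ at n (fromℕ k)
  at-fromℕ-suc n k = refl

  at-∑<-suc : ∀ n N f → at n (∑< (suc N) f) ≡ at n (∑< N f) ⊕ at n (f N)
  at-∑<-suc n N f = refl

module _ (n : ℕ) (X I : ℚ[i]) where
  open PowerSeries ℚ[i]-commutativeRing X I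
  open ≡-Reasoning

  at-∑< : ∀ N f → at n (∑< N f) ≡ sum N (λ k → at n (f k))
  at-∑< zero    f = at-0 n
  at-∑< (suc N) f = begin
    at n (∑< (suc N) f)              ≡⟨ at-∑<-suc n N f ⟩
    at n (∑< N f) ⊕ at n (f N)       ≡⟨ cong (_⊕ at n (f N)) (at-∑< N f) ⟩
    sum (suc N) (λ k → at n (f k))   ∎

  at-^ : ∀ z k → at n (z ^ℂ k) ≡ at n z ^ⁱ k
  at-^ z zero    = at-1 n
  at-^ z (suc k) = begin
    at n (z ^ℂ suc k)        ≡⟨ at-^-suc n z k ⟩
    at n z ⊗ at n (z ^ℂ k)   ≡⟨ cong (at n z ⊗_) (at-^ z k) ⟩
    at n z ^ⁱ suc k          ∎

  at-fromℕ : ∀ k → at n (fromℕ k) ≡ fromNat k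
  at-fromℕ zero    = at-0 n
  at-fromℕ (suc k) = begin
    at n (fromℕ (suc k))     ≡⟨ at-fromℕ-suc n k ⟩
    1ⁱ ⊕ at n (fromℕ k)      ≡⟨ cong (1ⁱ ⊕_) (at-fromℕ k) ⟩
    fromNat (suc k)          ∎

  at-monomial : ∀ c z k → at n (fromℕ c *ℂ z ^ℂ k) ≡ fromNat c ⊗ at n z ^ⁱ k
  at-monomial c z k = begin
    at n (fromℕ c *ℂ z ^ℂ k)           ≡⟨ at-fromℕ*^ n c z k ⟩
    at n (fromℕ c) ⊗ at n (z ^ℂ k)     ≡⟨ cong₂ _⊗_ (at-fromℕ c) (at-^ z k) ⟩
    fromNat c ⊗ at n z ^ⁱ k            ∎

  at-ω : ∀ p z → at n (ω p z) ≡ omega p (at n z)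
  at-ω p z = begin
    at n (ω p z)
      ≡⟨ at-∑< (suc p) term ⟩
    sum (suc p) (λ k → at n (term k))
      ≡⟨ sum-cong (suc p) (λ k → at-monomial (surjections p k) z k) ⟩
    omega p (at n z) ∎
    where
    term : ℕ → ℂ
    term k = fromℕ (stirling₂ p k ℕ.* k !) *ℂ z ^ℂ k

  at-limit : ∀ p x w k wᵏ≄0 w≄0 →
    at n (1ℂ ÷ (w ^ℂ k) [ wᵏ≄0 ] *ℂ ω p (x ÷ w [ w≄0 ])) ≡
    1ⁱ ⊗ inv (at n w ^ⁱ k) ⊗ omega p (at n x ⊗ inv (at n w))
  at-limit p x w k wᵏ≄0 w≄0 = begin
    at n (1ℂ ÷ (w ^ℂ k) [ wᵏ≄0 ] *ℂ ω p (x ÷ w [ w≄0 ]))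
      ≡⟨ at-1÷* n (w ^ℂ k) wᵏ≄0 (ω p (x ÷ w [ w≄0 ])) ⟩
    1ⁱ ⊗ inv (at n (w ^ℂ k)) ⊗ at n (ω p (x ÷ w [ w≄0 ]))
      ≡⟨ cong (1ⁱ ⊗ inv (at n (w ^ℂ k)) ⊗_) (at-ω p (x ÷ w [ w≄0 ])) ⟩
    1ⁱ ⊗ inv (at n (w ^ℂ k)) ⊗ omega p (at n (x ÷ w [ w≄0 ]))
      ≡⟨ cong (λ y → 1ⁱ ⊗ inv (at n (w ^ℂ k)) ⊗ omega p y) (at-÷ n x w w≄0) ⟩
    1ⁱ ⊗ inv (at n (w ^ℂ k)) ⊗ omega p (at n x ⊗ inv (at n w))
      ≡⟨ cong (λ v → 1ⁱ ⊗ inv v ⊗ omega p (at n x ⊗ inv (at n w))) (at-^ w k) ⟩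
    1ⁱ ⊗ inv (at n w ^ⁱ k) ⊗ omega p (at n x ⊗ inv (at n w)) ∎

-- The bound r is 1 - ε/2 when ∣ x ∣ + ε < 1 with ε rational.
closedDisc : ∀ x → ∣ x ∣ℂ <ℝ 1ℝ →
  ∃[ r ] 0ℚ ≤ r × r < 1ℚ × ∃[ M ] (∀ n → M ℕ.≤ n → at n x ≼ r)
closedDisc x@(a +i b) (ε , 0<ε , K , lt) =
  r , ≤-trans (0≤a+u M) (<⇒≤ (a+u<r M ℕ.≤-refl)) , r<1 , M , λ n le →
    bound (≤-trans (0≤a+u n) (<⇒≤ (a+u<r n le))) (begin
      norm (at n x)              ≡⟨ 0≤p⇒∣p∣≡p (0≤norm (at n x)) ⟨
      ∣ norm (at n x) ∣          ≤⟨ <⇒≤ (approxSqrt-upper (norm (at n x)) n) ⟩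
      a+u n * a+u n
        ≤⟨ *-mono-≤ (0≤a+u n) (<⇒≤ (a+u<r n le)) (0≤a+u n) (<⇒≤ (a+u<r n le)) ⟩
      r * r                      ∎)
  where
  open ≤-Reasoning
  r : ℚ
  r = 1ℚ - ½ * ε
  r<1 : r < 1ℚ
  r<1 = subst (r <_) (+-identityʳ 1ℚ) (+-monoʳ-< 1ℚ (neg-antimono-< (0<½* 0<ε)))
  L : ℕ
  L = proj₁ (unitFraction-small (0<½* 0<ε))
  M : ℕ
  M = K ℕ.⊔ L
  a+u : ℕ → ℚ
  a+u n = approxSqrt (norm (at n x)) n + unitFraction n
  0≤a+u : ∀ n → 0ℚ ≤ a+u n
  0≤a+u n = +-mono-≤ (0≤approxSqrt (norm (at n x)) n) (0≤unitFraction n)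
  a+u<r : ∀ n → M ℕ.≤ n → a+u n < r
  a+u<r n le = begin-strict
    a+u n
      <⟨ +-monoʳ-< α (proj₂ (unitFraction-small (0<½* 0<ε)) n (ℕ.m⊔n≤o⇒n≤o K L le)) ⟩
    α + ½ * ε
      ≡⟨ solve 2 (λ α ε → α :+ con ½ :* ε := α :+ ε :- con ½ :* ε) refl α ε ⟩
    α + ε - ½ * ε
      <⟨ +-monoˡ-< (- (½ * ε)) (lt n (ℕ.m⊔n≤o⇒m≤o K L le)) ⟩
    r ∎
    where
    α : ℚ
    α = approxSqrt (norm (at n x)) n

-- A record so that z can be inferred from the type, which `at n z` does not determine.
record Evaluates (M : ℕ) (z : ℂ) (v : ∀ n → M ℕ.≤ n → ℚ[i]) : Set where
  constructor evaluates
  field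
    at≡ : ∀ n M≤n → at n z ≡ v n M≤n

-- `approxSqrt` never exceeds the true root, so t bounds every late approximation of the distance.
-- As t < e/2 and ε eventually exceeds e, the other half of e is the margin that `_<ℝ_` requires.
∣-∣<-intro : ∀ {M S l u v t e} ε N → Evaluates M S u → Evaluates M l v →
  (∀ n M≤n → u n M≤n ⊕ ⊖ v n M≤n ≼ t) → 0ℚ < e → t < ½ * e →
  (∀ n → N ℕ.≤ n → 0ℚ + e < seq ε n) → ∣ S -ℂ l ∣ℂ <ℝ ε
∣-∣<-intro {M} {S} {l} {u} {v} {t} {e} ε N (evaluates at-S) (evaluates at-l) error≼t 0<e t<½e e<ε =
  ½ * e , 0<½* 0<e , M ℕ.⊔ N , λ n le →
  let α = approxSqrt (norm (at n (S -ℂ l))) n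
      M≤n = ℕ.m⊔n≤o⇒m≤o M N le
      bound 0≤t norm≤t² = subst (_≼ t) (sym (at-error n M≤n)) (error≼t n M≤n)
  in begin-strict
    α + ½ * e
      ≤⟨ +-monoˡ-≤ (½ * e) (a*a≤b*b⇒a≤b {α} 0≤t (begin
           α * α                           ≤⟨ approxSqrt-lower (norm (at n (S -ℂ l))) n ⟩
           ∣ norm (at n (S -ℂ l)) ∣        ≡⟨ 0≤p⇒∣p∣≡p (0≤norm (at n (S -ℂ l))) ⟩
           norm (at n (S -ℂ l))            ≤⟨ norm≤t² ⟩
           t * t                           ∎)) ⟩
    t + ½ * e         <⟨ +-monoˡ-< (½ * e) t<½e ⟩
    ½ * e + ½ * e     ≡⟨ ½+½ e ⟩
    e                 ≡⟨ +-identityˡ e ⟨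
    0ℚ + e            <⟨ e<ε n (ℕ.m⊔n≤o⇒n≤o M N le) ⟩
    seq ε n           ∎
  where
  open ≤-Reasoning
  at-error : ∀ n M≤n → at n (S -ℂ l) ≡ u n M≤n ⊕ ⊖ v n M≤n
  at-error n M≤n = trans (at-- n S l) (cong₂ (λ z w → z ⊕ ⊖ w) (at-S n M≤n) (at-l n M≤n))

-- The complex series through its rational approximations

module _ {r : ℚ} (0≤r : 0ℚ ≤ r) (r<1 : r < 1ℚ) where
  open UniformTail 0≤r r<1

  partialSum-evaluates : ∀ {M} p x N (x≼r : ∀ n → M ℕ.≤ n → at n x ≼ r) →
    Evaluates M (∑< N ((λ n → fromℕ (powerSum p n) *ℂ x ^ℂ n) ∘ suc))
                (λ n M≤n → partialSum (x≼r n M≤n) p N)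
  partialSum-evaluates p x N x≼r = evaluates λ n M≤n →
    let open PowerSeries ℚ[i]-commutativeRing (at n x) (I (x≼r n M≤n)) using (sum-cong)
    in trans (at-∑< n (at n x) (I (x≼r n M≤n)) N _)
             (sum-cong N (λ k → at-monomial n (at n x) (I (x≼r n M≤n)) (powerSum p (suc k)) x (suc k)))

  closedForm-evaluates : ∀ {M} p x (∣x∣<1 : ∣ x ∣ℂ <ℝ 1ℝ) →
    let 1-x≠0 = 1-x≄0 x ∣x∣<1 in (x≼r : ∀ n → M ℕ.≤ n → at n x ≼ r) →
    Evaluates M
      (1ℂ ÷ ((1ℂ -ℂ x) ^ℂ 2) [ ^-≄0 (1ℂ -ℂ x) 2 1-x≠0 ] *ℂ ω p (x ÷ (1ℂ -ℂ x) [ 1-x≠0 ]))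
      (λ n M≤n → limit (x≼r n M≤n) p)
  closedForm-evaluates p x ∣x∣<1 x≼r = evaluates λ n M≤n →
    let open PowerSeries ℚ[i]-commutativeRing (at n x) (I (x≼r n M≤n)) using (omega)
    in trans (at-limit n (at n x) (I (x≼r n M≤n)) p x (1ℂ -ℂ x) 2
               (^-≄0 (1ℂ -ℂ x) 2 (1-x≄0 x ∣x∣<1)) (1-x≄0 x ∣x∣<1))
             (cong (λ v → 1ⁱ ⊗ inv (v ^ⁱ 2) ⊗ omega p (at n x ⊗ inv v)) (at-1- n x))

mainTheorem3 : (p : ℕ) → p > 0 →
    (x : ℂ) (∣x∣<1 : ∣ x ∣ℂ <ℝ 1ℝ) →
    let 1-x≠0 = 1-x≄0 x ∣x∣<1 in
    ∑₁^∞ (λ n → fromℕ (powerSum p n) *ℂ x ^ℂ n) ≈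
    (1ℂ ÷ ((1ℂ -ℂ x) ^ℂ 2) [ ^-≄0 (1ℂ -ℂ x) 2 1-x≠0 ] *ℂ ω p (x ÷ (1ℂ -ℂ x) [ 1-x≠0 ]))
mainTheorem3 p p>0 x ∣x∣<1 ε (e , 0<e , L , e<ε) =
  let r , 0≤r , r<1 , M , x≼r = closedDisc x ∣x∣<1
      open UniformTail 0≤r r<1
      -- N₀ depends only on r, p and e, so one choice serves all late approximations of x at once.
      N₀ , small = Majorant.vanishes-tail 0≤r r<1 (<⇒≤ 0<s) p (½ * e) (0<½* 0<e)
  in N₀ , λ N N₀≤N → ∣-∣<-intro ε L
    (partialSum-evaluates 0≤r r<1 p x N x≼r)
    (closedForm-evaluates 0≤r r<1 p x ∣x∣<1 x≼r)
    (λ n M≤n → error-≼ (x≼r n M≤n) p p>0 N)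
    -- The N-th partial sum is controlled by the tail at N+1, hence the shifted index.
    0<e (small (suc N) (ℕ.m≤n⇒m≤1+n N₀≤N)) e<ε
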